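{- There exists a universal constant $C>0$ such that the following holds. Let $k\ge1$ be an integer, let $p_1<\dots<p_k$ be prime numbers, and let $$F=\big\{p_1^{\varepsilon_1}\cdots p_k^{\varepsilon_k}\ :\ \varepsilon_j\in\{0,1\},\ 1\le j\le k\big\}.$$ Let $B$ be a positive integer, and let $N(B,F)$ be the number of quadruples $(n_1,n_2,n_3,n_4)$ of integers with $n_1n_2=n_3n_4$, $1\le n_1\le B$, $1\le n_3\le B$, $n_2,n_4\in F$. Then $$N(B,F)\le C\,B\,2^k\prod_{i=1}^k\Big(1+\frac1{4p_i}\Big)\min\Big(B,\Big(\frac54\Big)^k\Big)+C\,2^k\prod_{i=1}^k\Big(1+\frac1{3p_i}\Big)\min\Big(B\Big(\frac32\Big)^k,2^k\Big).$$ Also, $$N(B,F)\ge 2^kB+2^kB\sum_{\substack{n\in F\\ 1<n\le B}}\frac{2^{ -\omega(n)}}{n}.$$ Further, if $F\subset[1,B]$, then $$N(B,F)\ge 2^kB\prod_{j=1}^k\Big(1+\frac1{2p_j}\Big).$$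
   Context: $\omega(n)$ denotes the number of distinct prime divisors of $n$, with $\omega(1)=0$. -}

module Defs where

import Algebra.Definitions.RawSemiring
open import Data.Fin.Base using (Fin; toℕ)
open import Data.Integer.Base using (+_)
open import Data.List.Base
  using (List; []; _∷_; length; map; filter; foldr; upTo; applyUpTo; allFin;
         cartesianProduct; cartesianProductWith; deduplicate)
open import Data.Nat.Base as ℕ using (ℕ; zero; suc)
open import Data.Nat.Divisibility using (_∣?_)
open import Data.Nat.Primality using (prime?)
open import Data.Nat.Properties using (_≟_)
open import Data.Product.Base using (_×_; _,_)
open import Data.Rational.Base as ℚ using (ℚ; 0ℚ; _/_)
open import Data.Vec.Base as Vec using (Vec; lookup)
open import Data.Vec.Functional using (Vector)
open import Relation.Binary.PropositionalEquality.Core using (_≡_)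
open import Relation.Nullary.Decidable using (_×-dec_)
open import Relation.Unary using (Decidable)

open Algebra.Definitions.RawSemiring ℕ.+-*-rawSemiring public
  using () renaming (product to ∏ℕ)
open Algebra.Definitions.RawSemiring ℚ.+-*-rawSemiring public
  using (_^_) renaming (product to ∏)

fromℕ : ℕ → ℚ
fromℕ n = + n / 1

-- 1 / n, with the convention 1 / 0 = 0.
recip : ℕ → ℚ
recip zero      = 0ℚ
recip n@(suc _) = + 1 / n

∑ : {A : Set} → List A → (A → ℚ) → ℚ
∑ xs f = foldr ℚ._+_ 0ℚ (map f xs)

-- The number of distinct prime divisors, for n ≥ 1: every divisor of n is then
-- among 0, …, n.
ω : ℕ → ℕ
ω n = length (filter (λ q → prime? q ×-dec (q ∣? n)) (upTo (suc n)))

-- All ε ∈ {0,1}ᵏ, each exactly once.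
exponents : ∀ k → List (Vec (Fin 2) k)
exponents zero    = Vec.[] ∷ []
exponents (suc k) = cartesianProductWith Vec._∷_ (allFin 2) (exponents k)

monomial : ∀ {k} → Vector ℕ k → Vec (Fin 2) k → ℕ
monomial p ε = ∏ℕ (λ j → p j ℕ.^ toℕ (lookup ε j))

-- The set F, as the list of its elements without repetition.
F : ∀ {k} → Vector ℕ k → List ℕ
F {k} p = deduplicate _≟_ (map (monomial p) (exponents k))

[1⋯_] : ℕ → List ℕ
[1⋯ B ] = applyUpTo suc B

Solution : ℕ × ℕ × ℕ × ℕ → Set
Solution (n₁ , n₂ , n₃ , n₄) = n₁ ℕ.* n₂ ≡ n₃ ℕ.* n₄

solution? : Decidable Solution
solution? (n₁ , n₂ , n₃ , n₄) = n₁ ℕ.* n₂ ≟ n₃ ℕ.* n₄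

-- S is a finite set of positive integers given as a list without repetition,
-- so the quadruples counted consist of positive integers and are distinct.
N : ℕ → List ℕ → ℕ
N B S =
  length (filter solution?
    (cartesianProduct [1⋯ B ]
      (cartesianProduct S (cartesianProduct [1⋯ B ] S))))

{-# OPTIONS --safe #-}
-- Write n₂ = ga and n₄ = gb with a, b coprime: the solutions of n₁n₂ = n₃n₄ are
-- n₁ = bt, n₃ = at, so N(B, F) is the sum of ⌊B / max(a, b)⌋ over all pairs
-- (n₂, n₄), that is, over all pairs (ε, δ) of exponent vectors.
--
-- Upper bound: the first of the two terms suffices.  Since n₄ is determined by
-- n₁, n₂, n₃, we have N ≤ 2ᵏB².  Next, max(a, b) ≥ √(ab) ≥ 4ᵈ, where d counts the
-- indices i with εᵢ ≠ δᵢ and pᵢ ≥ 16.  Summing 4⁻ᵈ over all (ε, δ) gives a factor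
-- 1 + ¼ + ¼ + 1 = 2 · 5/4 for every prime pᵢ ≥ 16 and 4 for the boundedly many
-- others, whence N ≤ C B 2ᵏ (5/4)ᵏ.
--
-- Lower bounds: keep the pairs with a = 1 or b = 1 only, and use 2⌊x⌋ ≥ x for
-- x ≥ 1.
module Submission where

open import Defs
open import Data.Fin.Base as Fin using (Fin; zero; suc; toℕ)
import Data.Fin.Properties as Fin
open import Data.Integer.Base as ℤ using (+_)
import Data.Integer.Properties as ℤ
open import Data.List.Base
  using (List; []; _∷_; _++_; length; map; filter; upTo; cartesianProductWith; cartesianProduct; deduplicate)
open import Data.List.Membership.Propositional using (_∈_)
open import Data.List.Membership.Propositional.Properties
open import Data.List.Properties using (length-++; length-map; length-applyUpTo; filter-all)
open import Data.List.Relation.Unary.All as All using ([])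
open import Data.List.Relation.Unary.Any using (here; there)
open import Data.List.Relation.Unary.Unique.Propositional using (Unique; []; _∷_)
import Data.List.Relation.Unary.Unique.Propositional.Properties as Unique
open import Data.Nat.Base as ℕ using (ℕ; zero; suc; s≤s; z≤n; z<s)
open import Data.Nat.Coprimality using (Coprime; coprime-divisor)
import Data.Nat.Coprimality as Coprimality
open import Data.Nat.DivMod using (m/n*n≡m; m/n*n≤m; /-monoˡ-≤; m%n<n; m≡m%n+[m/n]*n; m≥n⇒m/n>0)
open import Data.Nat.Divisibility
open import Data.Nat.Primality
import Data.Nat.Properties as ℕ
open import Data.Nat.Properties using (_<?_; _≤?_)
import Data.Nat.Solver as ℕSolver
open import Data.Product.Base using (_×_; _,_; proj₁; proj₂; ∃-syntax)
open import Data.Product.Properties using (,-injectiveʳ)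
open import Data.Rational.Base
  using (ℚ; 0ℚ; 1ℚ; ½; _/_; _+_; _*_; _⊓_; _≤_; _<_; fromℚᵘ; nonNegative)
open import Data.Rational.Properties hiding (_<?_; _≤?_)
import Data.Rational.Properties as ℚ
open import Data.Rational.Solver using (module +-*-Solver)
open import Data.Rational.Unnormalised.Base as ℚᵘ using (mkℚᵘ; *≡*)
import Data.Rational.Unnormalised.Properties as ℚᵘ
open import Data.Sum.Base using (_⊎_; inj₁; inj₂)
open import Data.Vec.Base as Vec using (Vec; []; _∷_)
open import Data.Vec.Functional using (Vector)
import Data.Vec.Properties as Vec
open import Function.Base using (_∘_; _$_; flip)
open import Level using (Level)
open import Relation.Binary.Definitions using (tri<; tri≈; tri>)
open import Relation.Binary.PropositionalEquality
open import Relation.Nullary.Decidable using (Dec; yes; no; ¬?; _×-dec_; toWitness)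
open import Relation.Nullary.Negation using (contradiction; ¬_)
open import Relation.Unary using (Decidable)

-- The maximum of a and b does not factor over the primes, but √(ab) does. Passing to √(ab) turns
-- the sum over all pairs into a product of local factors, one for each prime, which an induction on
-- k can evaluate. The threshold 16 = 4² is where √p reaches 4, the value for which the local factor
-- equals 2 · 5/4. Square roots are avoided: the induction carries integers g, a, b, w with w² ≤ ab.
-- In the lower bounds the obstacle is the floor: ⌊B/n⌋ may be close to half of B/n, while the
-- claimed inequalities have constant 1. The remedy is that every n > 1 arises twice, from pairs
-- with n₄ = n · n₂ and from their mirror images, so two floors are available for each term. For n =
-- 1 a pair is its own mirror image, but there the floor is exact.

private
  variable
    A B D : Set
    ℓ : Level
    k : ℕ

-- Rational arithmetic

-- Normalisation in `_/_` does not reduce for variable numerators, so identities about `fromℕ` and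
-- `recip` are checked on unnormalised fractions and carried over by `fromℚᵘ`.
fromℚᵘ-+ : ∀ p q → fromℚᵘ (p ℚᵘ.+ q) ≡ fromℚᵘ p + fromℚᵘ q
fromℚᵘ-+ p q = toℚᵘ-injective
  (ℚᵘ.≃-trans (toℚᵘ-fromℚᵘ (p ℚᵘ.+ q))
    (ℚᵘ.≃-sym (ℚᵘ.≃-trans (toℚᵘ-homo-+ (fromℚᵘ p) (fromℚᵘ q))
      (ℚᵘ.+-cong (toℚᵘ-fromℚᵘ p) (toℚᵘ-fromℚᵘ q)))))

fromℚᵘ-* : ∀ p q → fromℚᵘ (p ℚᵘ.* q) ≡ fromℚᵘ p * fromℚᵘ q
fromℚᵘ-* p q = toℚᵘ-injective
  (ℚᵘ.≃-trans (toℚᵘ-fromℚᵘ (p ℚᵘ.* q))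
    (ℚᵘ.≃-sym (ℚᵘ.≃-trans (toℚᵘ-homo-* (fromℚᵘ p) (fromℚᵘ q))
      (ℚᵘ.*-cong (toℚᵘ-fromℚᵘ p) (toℚᵘ-fromℚᵘ q)))))

fromℕ-+ : ∀ m n → fromℕ (m ℕ.+ n) ≡ fromℕ m + fromℕ n
fromℕ-+ m n = trans
  (fromℚᵘ-cong {mkℚᵘ (+ (m ℕ.+ n)) 0} {mkℚᵘ (+ m) 0 ℚᵘ.+ mkℚᵘ (+ n) 0}
    (*≡* (cong (ℤ._* + 1) (trans (ℤ.pos-+ m n)
      (sym (cong₂ ℤ._+_ (ℤ.*-identityʳ (+ m)) (ℤ.*-identityʳ (+ n))))))))
  (fromℚᵘ-+ (mkℚᵘ (+ m) 0) (mkℚᵘ (+ n) 0))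

fromℕ-* : ∀ m n → fromℕ (m ℕ.* n) ≡ fromℕ m * fromℕ n
fromℕ-* m n = trans
  (fromℚᵘ-cong {mkℚᵘ (+ (m ℕ.* n)) 0} {mkℚᵘ (+ m) 0 ℚᵘ.* mkℚᵘ (+ n) 0}
    (*≡* (cong (ℤ._* + 1) (ℤ.pos-* m n))))
  (fromℚᵘ-* (mkℚᵘ (+ m) 0) (mkℚᵘ (+ n) 0))

0≤fromℕ : ∀ n → 0ℚ ≤ fromℕ n
0≤fromℕ n = nonNegative⁻¹ (fromℕ n) {{normalize-nonNeg n 1}}

0≤recip : ∀ n → 0ℚ ≤ recip n
0≤recip zero      = ≤-refl
0≤recip n@(suc _) = nonNegative⁻¹ (recip n) {{normalize-nonNeg 1 n}}

fromℕ-mono : ∀ {m n} → m ℕ.≤ n → fromℕ m ≤ fromℕ n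
fromℕ-mono {m} {n} m≤n = begin
  fromℕ m                       ≡⟨ +-identityʳ (fromℕ m) ⟨
  fromℕ m + 0ℚ                  ≤⟨ +-monoʳ-≤ (fromℕ m) (0≤fromℕ (n ℕ.∸ m)) ⟩
  fromℕ m + fromℕ (n ℕ.∸ m)     ≡⟨ fromℕ-+ m (n ℕ.∸ m) ⟨
  fromℕ (m ℕ.+ (n ℕ.∸ m))       ≡⟨ cong fromℕ (ℕ.m+[n∸m]≡n m≤n) ⟩
  fromℕ n                       ∎
  where open ≤-Reasoning

recip-inverse : ∀ n .{{_ : ℕ.NonZero n}} → fromℕ n * recip n ≡ 1ℚ
recip-inverse n@(suc m) = trans
  (sym (fromℚᵘ-* (mkℚᵘ (+ n) 0) (mkℚᵘ (+ 1) m)))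
  (fromℚᵘ-cong {mkℚᵘ (+ n) 0 ℚᵘ.* mkℚᵘ (+ 1) m} {mkℚᵘ (+ 1) 0}
    (*≡* (trans (ℤ.*-identityʳ _) (trans (ℤ.*-identityʳ (+ n))
      (sym (trans (ℤ.*-identityˡ _) (cong +_ (ℕ.+-identityʳ n))))))))

*-monoʳ : ∀ {r p q} → 0ℚ ≤ r → p ≤ q → r * p ≤ r * q
*-monoʳ {r} 0≤r = *-monoˡ-≤-nonNeg r {{nonNegative 0≤r}}

*-monoˡ : ∀ {r p q} → 0ℚ ≤ r → p ≤ q → p * r ≤ q * r
*-monoˡ {r} 0≤r = *-monoʳ-≤-nonNeg r {{nonNegative 0≤r}}

*-mono : ∀ {p q r s} → 0ℚ ≤ q → 0ℚ ≤ r → p ≤ q → r ≤ s → p * r ≤ q * s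
*-mono 0≤q 0≤r p≤q r≤s = ≤-trans (*-monoˡ 0≤r p≤q) (*-monoʳ 0≤q r≤s)

0≤* : ∀ {p q} → 0ℚ ≤ p → 0ℚ ≤ q → 0ℚ ≤ p * q
0≤* {p} {q} 0≤p 0≤q = subst (_≤ p * q) (*-zeroʳ p) (*-monoʳ 0≤p 0≤q)

0≤+ : ∀ {p q} → 0ℚ ≤ p → 0ℚ ≤ q → 0ℚ ≤ p + q
0≤+ = +-mono-≤

0≤^ : ∀ {p} n → 0ℚ ≤ p → 0ℚ ≤ p ^ n
0≤^ zero    0≤p = ≤ᵇ⇒≤ _
0≤^ (suc n) 0≤p = 0≤* 0≤p (0≤^ n 0≤p)

^-distribʳ-* : ∀ p q n → (p * q) ^ n ≡ p ^ n * q ^ n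
^-distribʳ-* p q zero    = refl
^-distribʳ-* p q (suc n) = trans (cong (p * q *_) (^-distribʳ-* p q n))
  (solve 4 (λ a b c d → a :* b :* (c :* d) := a :* c :* (b :* d)) refl p q (p ^ n) (q ^ n))
  where open +-*-Solver

-- Uniqueness of inverses: both sides are inverse to `fromℕ m * fromℕ n`.
recip-* : ∀ m n .{{_ : ℕ.NonZero m}} .{{_ : ℕ.NonZero n}} →
          recip (m ℕ.* n) ≡ recip m * recip n
recip-* m n = begin
  r                                     ≡⟨ solve 1 (λ a → a := a :* con 1ℚ :* con 1ℚ) refl r ⟩
  r * 1ℚ * 1ℚ                           ≡⟨ cong₂ (λ a b → r * a * b) (recip-inverse m) (recip-inverse n) ⟨
  r * (M * recip m) * (N′ * recip n)    ≡⟨ solve 5 (λ a b c d e → a :* (b :* c) :* (d :* e) := b :* d :* a :* (c :* e))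
                                             refl r M (recip m) N′ (recip n) ⟩
  M * N′ * r * (recip m * recip n)      ≡⟨ cong (λ a → a * r * (recip m * recip n)) (fromℕ-* m n) ⟨
  fromℕ (m ℕ.* n) * r * (recip m * recip n)
    ≡⟨ cong (_* (recip m * recip n)) (recip-inverse (m ℕ.* n) {{ℕ.m*n≢0 m n}}) ⟩
  1ℚ * (recip m * recip n)              ≡⟨ *-identityˡ _ ⟩
  recip m * recip n                     ∎
  where
  open ≡-Reasoning
  open +-*-Solver
  r = recip (m ℕ.* n)
  M = fromℕ m
  N′ = fromℕ n

*≤⇒≤*recip : ∀ {c b} n .{{_ : ℕ.NonZero n}} → c ℕ.* n ℕ.≤ b → fromℕ c ≤ fromℕ b * recip n
*≤⇒≤*recip {c} {b} n cn≤b = begin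
  fromℕ c                       ≡⟨ *-identityʳ (fromℕ c) ⟨
  fromℕ c * 1ℚ                  ≡⟨ cong (fromℕ c *_) (recip-inverse n) ⟨
  fromℕ c * (fromℕ n * recip n) ≡⟨ *-assoc (fromℕ c) (fromℕ n) (recip n) ⟨
  fromℕ c * fromℕ n * recip n   ≡⟨ cong (_* recip n) (fromℕ-* c n) ⟨
  fromℕ (c ℕ.* n) * recip n     ≤⟨ *-monoˡ (0≤recip n) (fromℕ-mono cn≤b) ⟩
  fromℕ b * recip n             ∎
  where open ≤-Reasoning

≤*⇒*recip≤ : ∀ {c b} n .{{_ : ℕ.NonZero n}} → b ℕ.≤ c ℕ.* n → fromℕ b * recip n ≤ fromℕ c
≤*⇒*recip≤ {c} {b} n b≤cn = begin
  fromℕ b * recip n             ≤⟨ *-monoˡ (0≤recip n) (fromℕ-mono b≤cn) ⟩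
  fromℕ (c ℕ.* n) * recip n     ≡⟨ cong (_* recip n) (fromℕ-* c n) ⟩
  fromℕ c * fromℕ n * recip n   ≡⟨ *-assoc (fromℕ c) (fromℕ n) (recip n) ⟩
  fromℕ c * (fromℕ n * recip n) ≡⟨ cong (fromℕ c *_) (recip-inverse n) ⟩
  fromℕ c * 1ℚ                  ≡⟨ *-identityʳ (fromℕ c) ⟩
  fromℕ c                       ∎
  where open ≤-Reasoning

-- The main estimates are proved without the products over primes; this lets those products be
-- inserted afterwards.
1≤∏ : ∀ {k} (f : Fin k → ℚ) → (∀ i → 0ℚ ≤ f i) → 1ℚ ≤ ∏ (λ i → 1ℚ + f i)
1≤∏ {zero}  f 0≤f = ≤-refl
1≤∏ {suc k} f 0≤f = *-mono {1ℚ} {r = 1ℚ} (≤-trans (≤ᵇ⇒≤ _) 1≤) (≤ᵇ⇒≤ _) 1≤ (1≤∏ (f ∘ suc) (0≤f ∘ suc))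
  where
  1≤ : 1ℚ ≤ 1ℚ + f zero
  1≤ = +-monoʳ-≤ 1ℚ (0≤f zero)

-- Sums over lists

indicator : ∀ {P : Set ℓ} → Dec P → ℚ
indicator (yes _) = 1ℚ
indicator (no _)  = 0ℚ

0≤indicator : ∀ {P : Set ℓ} (P? : Dec P) → 0ℚ ≤ indicator P?
0≤indicator (yes _) = ≤ᵇ⇒≤ _
0≤indicator (no _)  = ≤-refl

indicator-true : ∀ {P : Set ℓ} (P? : Dec P) → P → indicator P? ≡ 1ℚ
indicator-true (yes _) p = refl
indicator-true (no ¬p) p = contradiction p ¬p

indicator-false : ∀ {P : Set ℓ} (P? : Dec P) → ¬ P → indicator P? ≡ 0ℚ
indicator-false (yes p) ¬p = contradiction p ¬p
indicator-false (no _)  ¬p = refl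

indicator-mono : ∀ {P Q : Set ℓ} (P? : Dec P) (Q? : Dec Q) → (P → Q) → indicator P? ≤ indicator Q?
indicator-mono (yes p) Q? P⇒Q = ≤-reflexive (sym (indicator-true Q? (P⇒Q p)))
indicator-mono (no _)  Q? P⇒Q = 0≤indicator Q?

∑-mono-∈ : (xs : List A) {f g : A → ℚ} → (∀ {x} → x ∈ xs → f x ≤ g x) → ∑ xs f ≤ ∑ xs g
∑-mono-∈ []       f≤g = ≤-refl
∑-mono-∈ (x ∷ xs) f≤g = +-mono-≤ (f≤g (here refl)) (∑-mono-∈ xs (f≤g ∘ there))

∑-mono : (xs : List A) {f g : A → ℚ} → (∀ x → f x ≤ g x) → ∑ xs f ≤ ∑ xs g
∑-mono xs f≤g = ∑-mono-∈ xs (λ {x} _ → f≤g x)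

∑-cong : (xs : List A) {f g : A → ℚ} → (∀ x → f x ≡ g x) → ∑ xs f ≡ ∑ xs g
∑-cong []       f≡g = refl
∑-cong (x ∷ xs) f≡g = cong₂ _+_ (f≡g x) (∑-cong xs f≡g)

∑-++ : (xs ys : List A) (f : A → ℚ) → ∑ (xs ++ ys) f ≡ ∑ xs f + ∑ ys f
∑-++ []       ys f = sym (+-identityˡ _)
∑-++ (x ∷ xs) ys f = trans (cong (_+_ (f x)) (∑-++ xs ys f)) (sym (+-assoc (f x) _ _))

∑-map : (xs : List A) (g : A → B) (f : B → ℚ) → ∑ (map g xs) f ≡ ∑ xs (f ∘ g)
∑-map []       g f = refl
∑-map (x ∷ xs) g f = cong (_+_ (f (g x))) (∑-map xs g f)

∑-cartesianProduct : (xs : List A) (ys : List B) (f : A × B → ℚ) →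
  ∑ (cartesianProduct xs ys) f ≡ ∑ xs (λ x → ∑ ys (λ y → f (x , y)))
∑-cartesianProduct []       ys f = refl
∑-cartesianProduct (x ∷ xs) ys f =
  trans (∑-++ (map (x ,_) ys) _ f) (cong₂ _+_ (∑-map ys (x ,_) f) (∑-cartesianProduct xs ys f))

∑-zero : (xs : List A) → ∑ xs (λ _ → 0ℚ) ≡ 0ℚ
∑-zero []       = refl
∑-zero (x ∷ xs) = trans (+-identityˡ _) (∑-zero xs)

∑-+ : (xs : List A) (f g : A → ℚ) → ∑ xs (λ x → f x + g x) ≡ ∑ xs f + ∑ xs g
∑-+ []       f g = refl
∑-+ (x ∷ xs) f g = trans (cong (_+_ (f x + g x)) (∑-+ xs f g))
  (solve 4 (λ a b c d → a :+ b :+ (c :+ d) := a :+ c :+ (b :+ d)) refl (f x) (g x) (∑ xs f) (∑ xs g))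
  where open +-*-Solver

∑-distribˡ-* : (c : ℚ) (xs : List A) (f : A → ℚ) → ∑ xs (λ x → c * f x) ≡ c * ∑ xs f
∑-distribˡ-* c []       f = sym (*-zeroʳ c)
∑-distribˡ-* c (x ∷ xs) f = trans (cong (_+_ (c * f x)) (∑-distribˡ-* c xs f)) (sym (*-distribˡ-+ c (f x) _))

∑-swap : (xs : List A) (ys : List B) (f : A → B → ℚ) →
  ∑ xs (λ x → ∑ ys (f x)) ≡ ∑ ys (λ y → ∑ xs (flip f y))
∑-swap []       ys f = sym (∑-zero ys)
∑-swap (x ∷ xs) ys f = trans (cong (_+_ (∑ ys (f x))) (∑-swap xs ys f)) (sym (∑-+ ys (f x) _))

∑-filter : {P : A → Set ℓ} (P? : Decidable P) (xs : List A) (f : A → ℚ) →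
  ∑ (filter P? xs) f ≡ ∑ xs (λ x → indicator (P? x) * f x)
∑-filter P? []       f = refl
∑-filter P? (x ∷ xs) f with P? x
... | yes _ = cong₂ _+_ (sym (*-identityˡ (f x))) (∑-filter P? xs f)
... | no _  = trans (∑-filter P? xs f) (trans (sym (+-identityˡ _)) (cong (_+ _) (sym (*-zeroˡ (f x)))))

fromℕ-length-filter : {P : A → Set ℓ} (P? : Decidable P) (xs : List A) →
  fromℕ (length (filter P? xs)) ≡ ∑ xs (λ x → indicator (P? x))
fromℕ-length-filter P? []       = refl
fromℕ-length-filter P? (x ∷ xs) with P? x
... | yes _ = trans (fromℕ-+ 1 (length (filter P? xs))) (cong (_+_ 1ℚ) (fromℕ-length-filter P? xs))
... | no _  = trans (fromℕ-length-filter P? xs) (sym (+-identityˡ _))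

∑-exponents : ∀ k (f : Vec (Fin 2) (suc k) → ℚ) →
  ∑ (exponents (suc k)) f ≡
  ∑ (exponents k) (f ∘ (zero Vec.∷_)) + ∑ (exponents k) (f ∘ (suc zero Vec.∷_))
∑-exponents k f = begin
  ∑ (map (zero Vec.∷_) es ++ map (suc zero Vec.∷_) es ++ []) f
    ≡⟨ ∑-++ (map (zero Vec.∷_) es) _ f ⟩
  ∑ (map (zero Vec.∷_) es) f + ∑ (map (suc zero Vec.∷_) es ++ []) f
    ≡⟨ cong₂ _+_ (∑-map es _ f)
         (trans (∑-++ (map (suc zero Vec.∷_) es) [] f) (trans (+-identityʳ _) (∑-map es _ f))) ⟩
  ∑ es (f ∘ (zero Vec.∷_)) + ∑ es (f ∘ (suc zero Vec.∷_)) ∎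
  where
  open ≡-Reasoning
  es = exponents k

-- Induction on `xs`: cut `f x` out of `ys`; by injectivity the remaining images survive the cut.
-- Injectivity is asked for on members only, because maps such as division by b are injective only
-- on the solutions being counted.
length-injection : {xs : List A} {ys : List B} (f : A → B) → Unique xs →
  (∀ {x y} → x ∈ xs → y ∈ xs → f x ≡ f y → x ≡ y) →
  (∀ {x} → x ∈ xs → f x ∈ ys) → length xs ℕ.≤ length ys
length-injection {xs = []}     f []        inj f∈ = ℕ.z≤n
length-injection {A = A} {B} {xs = x ∷ xs} f (x∉xs ∷ xs!) inj f∈
  with ∈-∃++ (f∈ (here refl))
... | as , bs , refl = begin
  suc (length xs)                   ≤⟨ ℕ.s≤s (length-injection f xs! (λ p q → inj (there p) (there q)) f∈′) ⟩
  suc (length (as ++ bs))           ≡⟨ cong suc (length-++ as) ⟩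
  suc (length as ℕ.+ length bs)     ≡⟨ ℕ.+-suc (length as) (length bs) ⟨
  length as ℕ.+ suc (length bs)     ≡⟨ length-++ as ⟨
  length (as ++ f x ∷ bs)           ∎
  where
  open ℕ.≤-Reasoning
  f∈′ : ∀ {y} → y ∈ xs → f y ∈ as ++ bs
  f∈′ {y} y∈ with ∈-++⁻ as (f∈ (there y∈))
  ... | inj₁ fy∈as           = ∈-++⁺ˡ fy∈as
  ... | inj₂ (here fy≡fx)    = contradiction (sym (inj (there y∈) (here refl) fy≡fx)) (All.lookup x∉xs y∈)
  ... | inj₂ (there fy∈bs)   = ∈-++⁺ʳ as fy∈bs

deduplicate-unique : ∀ {xs : List ℕ} → Unique xs → deduplicate ℕ._≟_ xs ≡ xs
deduplicate-unique []           = refl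
deduplicate-unique {x ∷ xs} (x∉xs ∷ xs!) rewrite deduplicate-unique xs! =
  cong (x ∷_) (filter-all (¬? ∘ (x ℕ.≟_)) x∉xs)

∈[1⋯]⁺ : ∀ {n i} → 1 ℕ.≤ i → i ℕ.≤ n → i ∈ [1⋯ n ]
∈[1⋯]⁺ {i = suc i} _ i≤n = ∈-applyUpTo⁺ suc i≤n

∈[1⋯]⁻ : ∀ {n i} → i ∈ [1⋯ n ] → 1 ℕ.≤ i × i ℕ.≤ n
∈[1⋯]⁻ i∈ with ∈-applyUpTo⁻ suc i∈
... | _ , i<n , refl = z<s , i<n

[1⋯]-unique : ∀ n → Unique [1⋯ n ]
[1⋯]-unique n = Unique.applyUpTo⁺₁ suc n (λ i<j _ eq → ℕ.<⇒≢ i<j (ℕ.suc-injective eq))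

length-cartesianProductWith : (f : A → B → D) (xs : List A) (ys : List B) →
  length (cartesianProductWith f xs ys) ≡ length xs ℕ.* length ys
length-cartesianProductWith f []       ys = refl
length-cartesianProductWith f (x ∷ xs) ys = trans (length-++ (map (f x) ys))
  (cong₂ ℕ._+_ (length-map (f x) ys) (length-cartesianProductWith f xs ys))

length-exponents : ∀ k → length (exponents k) ≡ 2 ℕ.^ k
length-exponents zero    = refl
length-exponents (suc k) = trans
  (length-cartesianProductWith Vec._∷_ (zero ∷ suc zero ∷ []) (exponents k))
  (cong (2 ℕ.*_) (length-exponents k))

exponents-unique : ∀ k → Unique (exponents k)
exponents-unique zero    = [] ∷ []
exponents-unique (suc k) = Unique.cartesianProductWith⁺ Vec._∷_ Vec.∷-injective
  (Unique.allFin⁺ 2) (exponents-unique k)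

-- Solutions of n₁ x = n₃ y

Proportional : ℕ → ℕ → ℕ × ℕ → Set
Proportional x y (m , n) = m ℕ.* x ≡ n ℕ.* y

proportional? : ∀ x y → Decidable (Proportional x y)
proportional? x y (m , n) = m ℕ.* x ℕ.≟ n ℕ.* y

proportionals : ℕ → ℕ → ℕ → List (ℕ × ℕ)
proportionals b x y = filter (proportional? x y) (cartesianProduct [1⋯ b ] [1⋯ b ])

∈-proportionals⁻ : ∀ {b} x y {m n} → (m , n) ∈ proportionals b x y →
  (1 ℕ.≤ m × m ℕ.≤ b) × (1 ℕ.≤ n × n ℕ.≤ b) × m ℕ.* x ≡ n ℕ.* y
∈-proportionals⁻ {b} x y mn∈ =
  let mn∈² , eq = ∈-filter⁻ (proportional? x y) {xs = cartesianProduct [1⋯ b ] [1⋯ b ]} mn∈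
      m∈ , n∈ = ∈-cartesianProduct⁻ [1⋯ b ] [1⋯ b ] mn∈²
  in ∈[1⋯]⁻ m∈ , ∈[1⋯]⁻ n∈ , eq

∈-proportionals⁺ : ∀ {b} x y {m n} → 1 ℕ.≤ m → m ℕ.≤ b → 1 ℕ.≤ n → n ℕ.≤ b →
  m ℕ.* x ≡ n ℕ.* y → (m , n) ∈ proportionals b x y
∈-proportionals⁺ x y 1≤m m≤b 1≤n n≤b eq =
  ∈-filter⁺ (proportional? x y) (∈-cartesianProduct⁺ (∈[1⋯]⁺ 1≤m m≤b) (∈[1⋯]⁺ 1≤n n≤b)) eq

proportionals-unique : ∀ b x y → Unique (proportionals b x y)
proportionals-unique b x y = Unique.filter⁺ (proportional? x y)
  (Unique.cartesianProduct⁺ ([1⋯]-unique b) ([1⋯]-unique b))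

count : ℕ → ℕ → ℕ → ℕ
count b x y = length (proportionals b x y)

-- Exchanging n₁ and n₃ reverses the roles of x and y.
count-swap : ∀ b x y → count b x y ℕ.≤ count b y x
count-swap b x y = length-injection {ys = proportionals b y x} (λ (m , n) → n , m) (proportionals-unique b x y)
  (λ { _ _ refl → refl })
  λ mn∈ → let (1≤m , m≤b) , (1≤n , n≤b) , eq = ∈-proportionals⁻ {b} x y mn∈
          in ∈-proportionals⁺ {b} y x 1≤n n≤b 1≤m m≤b (sym eq)

-- n₁ a = n₃ b with a, b coprime forces b ∣ n₁, and n₁ determines n₃.
count*≤ : ∀ bound g a b .{{_ : ℕ.NonZero g}} .{{_ : ℕ.NonZero b}} → Coprime a b →
  count bound (g ℕ.* a) (g ℕ.* b) ℕ.* b ℕ.≤ bound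
count*≤ bound g a b a⊥b = begin
  count bound (g ℕ.* a) (g ℕ.* b) ℕ.* b   ≤⟨ ℕ.*-monoˡ-≤ b count≤ ⟩
  bound ℕ./ b ℕ.* b                       ≤⟨ m/n*n≤m bound b ⟩
  bound                                   ∎
  where
  open ℕ.≤-Reasoning
  cancel-g : ∀ {m n} → m ℕ.* (g ℕ.* a) ≡ n ℕ.* (g ℕ.* b) → m ℕ.* a ≡ n ℕ.* b
  cancel-g {m} {n} eq = ℕ.*-cancelˡ-≡ (m ℕ.* a) (n ℕ.* b) g
    (trans (comm m a) (trans eq (sym (comm n b))))
    where
    comm : ∀ x y → g ℕ.* (x ℕ.* y) ≡ x ℕ.* (g ℕ.* y)
    comm x y = solve 3 (λ g x y → g :* (x :* y) := x :* (g :* y)) refl g x y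
      where open ℕSolver.+-*-Solver
  b∣ : ∀ {m n} → m ℕ.* (g ℕ.* a) ≡ n ℕ.* (g ℕ.* b) → b ∣ m
  b∣ {m} {n} eq = coprime-divisor (Coprimality.sym a⊥b)
    (divides n (trans (ℕ.*-comm a m) (cancel-g {m} {n} eq)))
  members = ∈-proportionals⁻ {bound} (g ℕ.* a) (g ℕ.* b)
  count≤ : count bound (g ℕ.* a) (g ℕ.* b) ℕ.≤ bound ℕ./ b
  count≤ = subst (count bound (g ℕ.* a) (g ℕ.* b) ℕ.≤_) (length-applyUpTo suc (bound ℕ./ b)) $
    length-injection (λ (m , n) → m ℕ./ b) (proportionals-unique bound (g ℕ.* a) (g ℕ.* b))
      inj into
    where
    inj : ∀ {u v} → u ∈ proportionals bound (g ℕ.* a) (g ℕ.* b) →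
      v ∈ proportionals bound (g ℕ.* a) (g ℕ.* b) → proj₁ u ℕ./ b ≡ proj₁ v ℕ./ b → u ≡ v
    inj {m , n} {m′ , n′} u∈ v∈ eq with members u∈ | members v∈
    ... | _ , _ , e | _ , _ , e′ = cong₂ _,_ m≡m′
      (ℕ.*-cancelʳ-≡ n n′ b (trans (sym (cancel-g {m} {n} e)) (trans (cong (ℕ._* a) m≡m′) (cancel-g {m′} {n′} e′))))
      where
      m≡m′ : m ≡ m′
      m≡m′ = trans (sym (m/n*n≡m (b∣ {m} {n} e))) (trans (cong (ℕ._* b) eq) (m/n*n≡m (b∣ {m′} {n′} e′)))
    into : ∀ {u} → u ∈ proportionals bound (g ℕ.* a) (g ℕ.* b) → proj₁ u ℕ./ b ∈ [1⋯ bound ℕ./ b ]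
    into {m , n} u∈ with members u∈
    ... | (1≤m , m≤bound) , _ , e = ∈[1⋯]⁺ (pos (m ℕ./ b) (m/n*n≡m (b∣ {m} {n} e))) (/-monoˡ-≤ b m≤bound)
      where
      pos : ∀ q → q ℕ.* b ≡ m → 1 ℕ.≤ q
      pos zero    0≡m = contradiction 1≤m (ℕ.<-irrefl 0≡m)
      pos (suc _) _   = z<s

-- Explicit solutions: the pairs (tn, t) with 1 ≤ t ≤ ⌊bound / n⌋.
count≥/ : ∀ bound x n .{{_ : ℕ.NonZero n}} → bound ℕ./ n ℕ.≤ count bound x (x ℕ.* n)
count≥/ bound x n = subst (ℕ._≤ count bound x (x ℕ.* n)) (length-applyUpTo suc (bound ℕ./ n)) $
  length-injection (λ t → t ℕ.* n , t) ([1⋯]-unique (bound ℕ./ n)) (λ _ _ → ,-injectiveʳ)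
    λ {t} t∈ → let 1≤t , t≤ = ∈[1⋯]⁻ t∈
                   tn≤ = ℕ.≤-trans (ℕ.*-monoˡ-≤ n t≤) (m/n*n≤m bound n)
                   t≤tn = ℕ.m≤m*n t n
      in ∈-proportionals⁺ x (x ℕ.* n) (ℕ.≤-trans 1≤t t≤tn) tn≤ 1≤t (ℕ.≤-trans t≤tn tn≤)
           (trans (ℕ.*-assoc t n x) (cong (t ℕ.*_) (ℕ.*-comm n x)))

-- The first three coordinates of a solution determine the fourth.
N≤ : ∀ b {S} → Unique S → N b S ℕ.≤ b ℕ.* (length S ℕ.* b)
N≤ b {S} S! = begin
  N b S                                            ≤⟨ length-injection first₃
                                                        (Unique.filter⁺ solution? (Unique.cartesianProduct⁺ ([1⋯]-unique b)
                                                          (Unique.cartesianProduct⁺ S! (Unique.cartesianProduct⁺ ([1⋯]-unique b) S!))))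
                                                        inj into ⟩
  length (cartesianProduct [1⋯ b ] (cartesianProduct S [1⋯ b ]))
    ≡⟨ trans (length-cartesianProductWith _,_ [1⋯ b ] _) (cong₂ ℕ._*_ (length-applyUpTo suc b)
         (trans (length-cartesianProductWith _,_ S [1⋯ b ]) (cong (length S ℕ.*_) (length-applyUpTo suc b)))) ⟩
  b ℕ.* (length S ℕ.* b)                           ∎
  where
  open ℕ.≤-Reasoning
  first₃ : ℕ × ℕ × ℕ × ℕ → ℕ × ℕ × ℕ
  first₃ (n₁ , n₂ , n₃ , n₄) = n₁ , n₂ , n₃
  quadruples = cartesianProduct [1⋯ b ] (cartesianProduct S (cartesianProduct [1⋯ b ] S))
  members : ∀ {n₁ n₂ n₃ n₄} → (n₁ , n₂ , n₃ , n₄) ∈ filter solution? quadruples →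
    n₁ ∈ [1⋯ b ] × n₂ ∈ S × n₃ ∈ [1⋯ b ] × n₁ ℕ.* n₂ ≡ n₃ ℕ.* n₄
  members q∈ =
    let q∈′ , eq = ∈-filter⁻ solution? {xs = quadruples} q∈
        n₁∈ , q∈″ = ∈-cartesianProduct⁻ [1⋯ b ] _ q∈′
        n₂∈ , q∈‴ = ∈-cartesianProduct⁻ S _ q∈″
        n₃∈ , _ = ∈-cartesianProduct⁻ [1⋯ b ] S q∈‴
    in n₁∈ , n₂∈ , n₃∈ , eq
  inj : ∀ {u v} → u ∈ filter solution? quadruples → v ∈ filter solution? quadruples →
    first₃ u ≡ first₃ v → u ≡ v
  inj {n₁ , n₂ , n₃ , n₄} {_ , _ , _ , n₄′} u∈ v∈ refl with members u∈ | members v∈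
  ... | _ , _ , n₃∈ , e | _ , _ , _ , e′ =
    cong (λ n → n₁ , n₂ , n₃ , n)
      (ℕ.*-cancelˡ-≡ n₄ n₄′ n₃ {{ℕ.>-nonZero (proj₁ (∈[1⋯]⁻ n₃∈))}} (trans (sym e) e′))
  into : ∀ {u} → u ∈ filter solution? quadruples →
    first₃ u ∈ cartesianProduct [1⋯ b ] (cartesianProduct S [1⋯ b ])
  into u∈ with members u∈
  ... | n₁∈ , n₂∈ , n₃∈ , _ = ∈-cartesianProduct⁺ n₁∈ (∈-cartesianProduct⁺ n₂∈ n₃∈)

-- As sums of indicators the four nested enumerations can be reordered, so that n₂ and n₄ come
-- outside and n₁, n₃ inside.
N≡∑∑count : ∀ b S → fromℕ (N b S) ≡ ∑ S (λ x → ∑ S (λ y → fromℕ (count b x y)))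
N≡∑∑count b S = begin
  fromℕ (N b S)
    ≡⟨ fromℕ-length-filter solution? (cartesianProduct I (cartesianProduct S (cartesianProduct I S))) ⟩
  ∑ (cartesianProduct I (cartesianProduct S (cartesianProduct I S))) (indicator ∘ solution?)
    ≡⟨ trans (∑-cartesianProduct I _ _) (∑-cong I λ m →
         trans (∑-cartesianProduct S _ _) (∑-cong S λ x →
           trans (∑-cartesianProduct I S _) (∑-swap I S _))) ⟩
  ∑ I (λ m → ∑ S λ x → ∑ S λ y → ∑ I λ n → ind m x n y)
    ≡⟨ trans (∑-swap I S _) (∑-cong S λ x → ∑-swap I S _) ⟩
  ∑ S (λ x → ∑ S λ y → ∑ I λ m → ∑ I λ n → ind m x n y)
    ≡⟨ ∑-cong S (λ x → ∑-cong S λ y → sym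
         (trans (fromℕ-length-filter (proportional? x y) (cartesianProduct I I)) (∑-cartesianProduct I I _))) ⟩
  ∑ S (λ x → ∑ S λ y → fromℕ (count b x y)) ∎
  where
  open ≡-Reasoning
  I = [1⋯ b ]
  ind = λ m x n y → indicator (solution? (m , x , n , y))

-- Squarefree products of distinct primes

AllPrime : Vector ℕ k → Set
AllPrime p = ∀ i → Prime (p i)

Distinct : Vector ℕ k → Set
Distinct p = ∀ {i j} → p i ≡ p j → i ≡ j

Distinct-tail : {p : Vector ℕ (suc k)} → Distinct p → Distinct (p ∘ suc)
Distinct-tail p! eq with p! eq
... | refl = refl

monomial-nonZero : (p : Vector ℕ k) → AllPrime p → ∀ ε → ℕ.NonZero (monomial p ε)
monomial-nonZero p pp []       = _
monomial-nonZero p pp (e ∷ ε) = ℕ.m*n≢0 _ _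
  {{ℕ.m^n≢0 (p zero) (toℕ e) {{prime⇒nonZero (pp zero)}}}} {{monomial-nonZero (p ∘ suc) (pp ∘ suc) ε}}

prime∣prime⇒≡ : ∀ {q r} → Prime q → Prime r → q ∣ r → q ≡ r
prime∣prime⇒≡ q-prime r-prime q∣r with prime⇒irreducible r-prime q∣r
... | inj₁ refl = contradiction q-prime ¬prime[1]
... | inj₂ q≡r  = q≡r

prime∣monomial : (p : Vector ℕ k) → AllPrime p → ∀ ε {q} → Prime q → q ∣ monomial p ε → ∃[ i ] q ≡ p i
prime∣monomial p pp [] q-prime q∣1 with refl ← ∣1⇒≡1 q∣1 = contradiction q-prime ¬prime[1]
prime∣monomial p pp (zero ∷ ε) q-prime q∣ =
  let i , eq = prime∣monomial (p ∘ suc) (pp ∘ suc) ε q-prime (subst (_ ∣_) (ℕ.*-identityˡ _) q∣)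
  in suc i , eq
prime∣monomial p pp (suc zero ∷ ε) q-prime q∣ with euclidsLemma _ _ q-prime q∣
... | inj₁ q∣p₀ = zero , prime∣prime⇒≡ q-prime (pp zero) (subst (_ ∣_) (ℕ.*-identityʳ (p zero)) q∣p₀)
... | inj₂ q∣m  = let i , eq = prime∣monomial (p ∘ suc) (pp ∘ suc) ε q-prime q∣m in suc i , eq

head∤monomial-tail : (p : Vector ℕ (suc k)) → AllPrime p → Distinct p → ∀ ε → p zero ∤ monomial (p ∘ suc) ε
head∤monomial-tail p pp p! ε p₀∣ with prime∣monomial (p ∘ suc) (pp ∘ suc) ε (pp zero) p₀∣
... | i , eq with () ← p! eq

head∣monomial : (p : Vector ℕ (suc k)) → ∀ ε → p zero ∣ monomial p (suc zero ∷ ε)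
head∣monomial p ε = ∣-trans (m∣m*n 1) (m∣m*n (monomial (p ∘ suc) ε))

-- Unique factorisation in the squarefree case: if the first exponents differ, `p zero` divides
-- exactly one of the two products; if they agree, the common factor cancels.
monomial-injective : (p : Vector ℕ k) → AllPrime p → Distinct p → ∀ {ε δ} →
  monomial p ε ≡ monomial p δ → ε ≡ δ
monomial-injective p pp p! {[]}    {[]}    eq = refl
monomial-injective p pp p! {zero ∷ ε} {zero ∷ δ} eq =
  cong (zero ∷_) (monomial-injective (p ∘ suc) (pp ∘ suc) (Distinct-tail p!)
    (ℕ.*-cancelˡ-≡ (monomial (p ∘ suc) ε) (monomial (p ∘ suc) δ) 1 eq))
monomial-injective p pp p! {suc zero ∷ ε} {suc zero ∷ δ} eq =
  cong (suc zero ∷_) (monomial-injective (p ∘ suc) (pp ∘ suc) (Distinct-tail p!)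
    (ℕ.*-cancelˡ-≡ (monomial (p ∘ suc) ε) (monomial (p ∘ suc) δ) (p zero ℕ.^ 1)
      {{ℕ.m^n≢0 (p zero) 1 {{prime⇒nonZero (pp zero)}}}} eq))
monomial-injective p pp p! {zero ∷ ε} {suc zero ∷ δ} eq =
  contradiction (subst (p zero ∣_) (trans (sym eq) (ℕ.*-identityˡ _)) (head∣monomial p δ))
    (head∤monomial-tail p pp p! ε)
monomial-injective p pp p! {suc zero ∷ ε} {zero ∷ δ} eq =
  contradiction (subst (p zero ∣_) (trans eq (ℕ.*-identityˡ _)) (head∣monomial p ε))
    (head∤monomial-tail p pp p! δ)

F≡map : (p : Vector ℕ k) → AllPrime p → Distinct p → F p ≡ map (monomial p) (exponents k)
F≡map {k} p pp p! = deduplicate-unique (Unique.map⁺ (monomial-injective p pp p!) (exponents-unique k))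

support : Vector ℕ k → Vec (Fin 2) k → List ℕ
support p []             = []
support p (zero ∷ ε)     = support (p ∘ suc) ε
support p (suc zero ∷ ε) = p zero ∷ support (p ∘ suc) ε

∈-support : (p : Vector ℕ k) → ∀ ε {q} → q ∈ support p ε → (∃[ i ] q ≡ p i) × q ∣ monomial p ε
∈-support p (zero ∷ ε) q∈ =
  let (i , eq) , q∣ = ∈-support (p ∘ suc) ε q∈ in (suc i , eq) , ∣n⇒∣m*n 1 q∣
∈-support p (suc zero ∷ ε) (here refl) = (zero , refl) , head∣monomial p ε
∈-support p (suc zero ∷ ε) (there q∈) =
  let (i , eq) , q∣ = ∈-support (p ∘ suc) ε q∈ in (suc i , eq) , ∣n⇒∣m*n (p zero ℕ.^ 1) q∣

support-unique : (p : Vector ℕ k) → Distinct p → ∀ ε → Unique (support p ε)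
support-unique p p! []             = []
support-unique p p! (zero ∷ ε)     = support-unique (p ∘ suc) (Distinct-tail p!) ε
support-unique p p! (suc zero ∷ ε) = All.tabulate p₀≢ ∷ support-unique (p ∘ suc) (Distinct-tail p!) ε
  where
  p₀≢ : ∀ {q} → q ∈ support (p ∘ suc) ε → p zero ≢ q
  p₀≢ q∈ refl with proj₁ (∈-support (p ∘ suc) ε q∈)
  ... | i , eq with () ← p! eq

-- Every chosen prime is among the divisors that `ω` counts. This direction is the one that bounds
-- 2^(-ω(n)) from above by a weight defined on exponent vectors.
length-support≤ω : (p : Vector ℕ k) → AllPrime p → Distinct p → ∀ ε →
  length (support p ε) ℕ.≤ ω (monomial p ε)
length-support≤ω p pp p! ε = length-injection (λ q → q) (support-unique p p! ε) (λ _ _ eq → eq) into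
  where
  into : ∀ {q} → q ∈ support p ε →
    q ∈ filter (λ q → prime? q ×-dec (q ∣? monomial p ε)) (upTo (suc (monomial p ε)))
  into q∈ with ∈-support p ε q∈
  ... | (i , refl) , q∣ = ∈-filter⁺ (λ q → prime? q ×-dec (q ∣? monomial p ε)) (∈-upTo⁺ (s≤s (∣⇒≤ {{monomial-nonZero p pp ε}} q∣))) (pp i , q∣)

StrictlyIncreasing : Vector ℕ k → Set
StrictlyIncreasing p = ∀ i j → i Fin.< j → p i ℕ.< p j

StrictlyIncreasing⇒Distinct : {p : Vector ℕ k} → StrictlyIncreasing p → Distinct p
StrictlyIncreasing⇒Distinct p↑ {i} {j} eq with Fin.<-cmp i j
... | tri< i<j _ _ = contradiction (p↑ i j i<j) (ℕ.<-irrefl eq)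
... | tri≈ _ i≡j _ = i≡j
... | tri> _ _ j<i = contradiction (p↑ j i j<i) (ℕ.<-irrefl (sym eq))

-- Sums over pairs of exponent vectors

pairSum : ∀ k → (Vec (Fin 2) k → Vec (Fin 2) k → ℚ) → ℚ
pairSum k f = ∑ (exponents k) λ ε → ∑ (exponents k) (f ε)

pairSum-mono : {f g : Vec (Fin 2) k → Vec (Fin 2) k → ℚ} → (∀ ε δ → f ε δ ≤ g ε δ) → pairSum k f ≤ pairSum k g
pairSum-mono {k} f≤g = ∑-mono (exponents k) λ ε → ∑-mono (exponents k) (f≤g ε)

pairSum-cong : {f g : Vec (Fin 2) k → Vec (Fin 2) k → ℚ} → (∀ ε δ → f ε δ ≡ g ε δ) → pairSum k f ≡ pairSum k g
pairSum-cong {k} f≡g = ∑-cong (exponents k) λ ε → ∑-cong (exponents k) (f≡g ε)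

pairSum-distribˡ-* : ∀ c (f : Vec (Fin 2) k → Vec (Fin 2) k → ℚ) → pairSum k (λ ε δ → c * f ε δ) ≡ c * pairSum k f
pairSum-distribˡ-* {k} c f = trans (∑-cong (exponents k) λ ε → ∑-distribˡ-* c (exponents k) (f ε))
  (∑-distribˡ-* c (exponents k) _)

-- Allows two pair sums to be compared when only their symmetrised summands are comparable.
pairSum-+-flip : (f : Vec (Fin 2) k → Vec (Fin 2) k → ℚ) → pairSum k (λ ε δ → f ε δ + f δ ε) ≡ pairSum k f + pairSum k f
pairSum-+-flip {k} f = begin
  pairSum k (λ ε δ → f ε δ + f δ ε)     ≡⟨ ∑-cong es (λ ε → ∑-+ es (f ε) (flip f ε)) ⟩
  ∑ es (λ ε → ∑ es (f ε) + ∑ es (flip f ε)) ≡⟨ ∑-+ es _ _ ⟩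
  pairSum k f + pairSum k (flip f)      ≡⟨ cong (_+_ (pairSum k f)) (∑-swap es es (flip f)) ⟩
  pairSum k f + pairSum k f             ∎
  where
  open ≡-Reasoning
  es = exponents k

-- The four choices of first exponents are the source of the local factor at `p zero` in both
-- bounds.
pairSum-suc : (f : Vec (Fin 2) (suc k) → Vec (Fin 2) (suc k) → ℚ) →
  pairSum (suc k) f ≡
    (pairSum k (λ ε δ → f (zero ∷ ε) (zero ∷ δ)) + pairSum k (λ ε δ → f (zero ∷ ε) (suc zero ∷ δ)))
    + (pairSum k (λ ε δ → f (suc zero ∷ ε) (zero ∷ δ)) + pairSum k (λ ε δ → f (suc zero ∷ ε) (suc zero ∷ δ)))
pairSum-suc {k} f = trans (∑-exponents k _) (cong₂ _+_ (inner (f ∘ (zero ∷_))) (inner (f ∘ (suc zero ∷_))))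
  where
  inner : (g : Vec (Fin 2) k → Vec (Fin 2) (suc k) → ℚ) →
    ∑ (exponents k) (λ ε → ∑ (exponents (suc k)) (g ε)) ≡
    pairSum k (λ ε δ → g ε (zero ∷ δ)) + pairSum k (λ ε δ → g ε (suc zero ∷ δ))
  inner g = trans (∑-cong (exponents k) (λ ε → ∑-exponents k (g ε))) (∑-+ (exponents k) _ _)

N≡pairSum : ∀ b (p : Vector ℕ k) → AllPrime p → Distinct p →
  fromℕ (N b (F p)) ≡ pairSum k (λ ε δ → fromℕ (count b (monomial p ε) (monomial p δ)))
N≡pairSum {k} b p pp p! rewrite F≡map p pp p! = trans (N≡∑∑count b (map (monomial p) (exponents k)))
  (trans (∑-map (exponents k) (monomial p) _) (∑-cong (exponents k) λ ε → ∑-map (exponents k) (monomial p) _))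

-- Upper bound

-- A lower bound for √q that is 4 for all but finitely many primes q.
big : ℕ → ℕ
big q with 16 ℕ.≤? q
... | yes _ = 4
... | no _  = 1

weight : ℕ → Fin 2 → Fin 2 → ℕ
weight q zero       zero       = 1
weight q zero       (suc zero) = big q
weight q (suc zero) zero       = big q
weight q (suc zero) (suc zero) = 1

-- This is the 4ᵈ of the overview; its reciprocal is a product of local terms.
weights : Vector ℕ k → Vec (Fin 2) k → Vec (Fin 2) k → ℕ
weights p []      []      = 1
weights p (i ∷ ε) (j ∷ δ) = weight (p zero) i j ℕ.* weights (p ∘ suc) ε δ

big-nonZero : ∀ q → ℕ.NonZero (big q)
big-nonZero q with 16 ℕ.≤? q
... | yes _ = _
... | no _  = _

big²≤ : ∀ q .{{_ : ℕ.NonZero q}} → big q ℕ.* big q ℕ.≤ q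
big²≤ q with 16 ℕ.≤? q
... | yes 16≤q = 16≤q
... | no _     = ℕ.>-nonZero⁻¹ q

weight-nonZero : ∀ q i j → ℕ.NonZero (weight q i j)
weight-nonZero q zero       zero       = _
weight-nonZero q zero       (suc zero) = big-nonZero q
weight-nonZero q (suc zero) zero       = big-nonZero q
weight-nonZero q (suc zero) (suc zero) = _

weights-nonZero : (p : Vector ℕ k) → ∀ ε δ → ℕ.NonZero (weights p ε δ)
weights-nonZero p []      []      = _
weights-nonZero p (i ∷ ε) (j ∷ δ) =
  ℕ.m*n≢0 _ _ {{weight-nonZero (p zero) i j}} {{weights-nonZero (p ∘ suc) ε δ}}

-- The invariant of the induction on k. The last field is w ≤ √(ab) with the root cleared.
record CoprimeParts (x y w : ℕ) : Set where
  constructor coprimeParts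
  field
    g a b   : ℕ
    x≡ga    : x ≡ g ℕ.* a
    y≡gb    : y ≡ g ℕ.* b
    coprime : Coprime a b
    w²≤ab   : w ℕ.* w ℕ.≤ a ℕ.* b

CoprimeParts-sym : ∀ {x y w} → CoprimeParts x y w → CoprimeParts y x w
CoprimeParts-sym {w = w} (coprimeParts g a b x≡ y≡ a⊥b w²≤) =
  coprimeParts g b a y≡ x≡ (Coprimality.sym a⊥b) (subst (w ℕ.* w ℕ.≤_) (ℕ.*-comm a b) w²≤)

-- A common factor is absorbed by g. The factor 1 in `1 ℕ.* w` matches how `weights` unfolds at
-- equal exponents.
CoprimeParts-common : ∀ {x y w} q → CoprimeParts x y w → CoprimeParts (q ℕ.* x) (q ℕ.* y) (1 ℕ.* w)
CoprimeParts-common {w = w} q (coprimeParts g a b refl refl a⊥b w²≤) =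
  coprimeParts (q ℕ.* g) a b (sym (ℕ.*-assoc q g a)) (sym (ℕ.*-assoc q g b)) a⊥b
    (subst (λ v → v ℕ.* v ℕ.≤ a ℕ.* b) (sym (ℕ.*-identityˡ w)) w²≤)

-- A common divisor d of qa and b is coprime to q, since otherwise q would divide b; hence d divides
-- a.
coprime-prime*ˡ : ∀ {q a b} → Prime q → q ∤ b → Coprime a b → Coprime (q ℕ.* a) b
coprime-prime*ˡ {q} {a} {b} q-prime q∤b a⊥b {d} (d∣qa , d∣b) = a⊥b (coprime-divisor d⊥q d∣qa , d∣b)
  where
  d⊥q : Coprime d q
  d⊥q (e∣d , e∣q) with prime⇒irreducible q-prime e∣q
  ... | inj₁ e≡1  = e≡1
  ... | inj₂ refl = contradiction (∣-trans e∣d d∣b) q∤b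

-- As b divides y, q does not divide b, so q can join a. Then ab grows by the factor q, which pays
-- for the square of `big q`.
CoprimeParts-prime : ∀ {x y w q} → Prime q → q ∤ y →
  CoprimeParts x y w → CoprimeParts (q ℕ.^ 1 ℕ.* x) (1 ℕ.* y) (big q ℕ.* w)
CoprimeParts-prime {w = w} {q} q-prime q∤y (coprimeParts g a b refl refl a⊥b w²≤) =
  coprimeParts g (q ℕ.* a) b
    (solve 3 (λ q g a → q :* con 1 :* (g :* a) := g :* (q :* a)) refl q g a)
    (ℕ.*-identityˡ (g ℕ.* b))
    (coprime-prime*ˡ q-prime (λ q∣b → q∤y (∣n⇒∣m*n g q∣b)) a⊥b)
    (begin
      big q ℕ.* w ℕ.* (big q ℕ.* w)   ≡⟨ solve 2 (λ c w → c :* w :* (c :* w) := c :* c :* (w :* w)) refl (big q) w ⟩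
      big q ℕ.* big q ℕ.* (w ℕ.* w)   ≤⟨ ℕ.*-mono-≤ (big²≤ q {{prime⇒nonZero q-prime}}) w²≤ ⟩
      q ℕ.* (a ℕ.* b)                 ≡⟨ ℕ.*-assoc q a b ⟨
      q ℕ.* a ℕ.* b                   ∎)
  where
  open ℕ.≤-Reasoning
  open ℕSolver.+-*-Solver

monomial-coprimeParts : (p : Vector ℕ k) → AllPrime p → Distinct p → ∀ ε δ →
  CoprimeParts (monomial p ε) (monomial p δ) (weights p ε δ)
monomial-coprimeParts p pp p! []      []      =
  coprimeParts 1 1 1 refl refl (λ (d∣1 , _) → ∣1⇒≡1 d∣1) ℕ.≤-refl
monomial-coprimeParts p pp p! (i ∷ ε) (j ∷ δ)
  with monomial-coprimeParts (p ∘ suc) (pp ∘ suc) (Distinct-tail p!) ε δ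
monomial-coprimeParts p pp p! (zero     ∷ ε) (zero     ∷ δ) | parts = CoprimeParts-common 1 parts
monomial-coprimeParts p pp p! (suc zero ∷ ε) (suc zero ∷ δ) | parts = CoprimeParts-common (p zero ℕ.^ 1) parts
monomial-coprimeParts p pp p! (suc zero ∷ ε) (zero     ∷ δ) | parts =
  CoprimeParts-prime (pp zero) (head∤monomial-tail p pp p! δ) parts
monomial-coprimeParts p pp p! (zero     ∷ ε) (suc zero ∷ δ) | parts = CoprimeParts-sym
  (CoprimeParts-prime (pp zero) (head∤monomial-tail p pp p! ε) (CoprimeParts-sym parts))

-- From w² ≤ ab it follows that w ≤ a or w ≤ b, and the count times either cofactor is at most the
-- bound.
count*weight≤ : ∀ bound {x y w} .{{_ : ℕ.NonZero x}} .{{_ : ℕ.NonZero y}} →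
  CoprimeParts x y w → count bound x y ℕ.* w ℕ.≤ bound
count*weight≤ bound {w = w} (coprimeParts g a b refl refl a⊥b w²≤ab) with w ℕ.≤? a | w ℕ.≤? b
... | _       | yes w≤b = ℕ.≤-trans (ℕ.*-monoʳ-≤ (count bound (g ℕ.* a) (g ℕ.* b)) w≤b)
  (count*≤ bound g a b {{ℕ.m*n≢0⇒m≢0 g}} {{ℕ.m*n≢0⇒n≢0 g}} a⊥b)
... | yes w≤a | no _    = ℕ.≤-trans (ℕ.*-mono-≤ (count-swap bound (g ℕ.* a) (g ℕ.* b)) w≤a)
  (count*≤ bound g b a {{ℕ.m*n≢0⇒m≢0 g}} {{ℕ.m*n≢0⇒n≢0 g}} (Coprimality.sym a⊥b))
... | no w≰a  | no w≰b  = contradiction (ℕ.*-mono-< (ℕ.≰⇒> w≰a) (ℕ.≰⇒> w≰b)) (ℕ.≤⇒≯ w²≤ab)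

-- Since p is increasing, at most 16 of its entries are below 16, and each of
-- those costs a factor (1 + 1 + 1 + 1) / (1 + ¼ + ¼ + 1) ≤ 2.
pairSum-weights : ∀ m (p : Vector ℕ k) → StrictlyIncreasing p → (∀ i → m ℕ.≤ p i) →
  pairSum k (λ ε δ → recip (weights p ε δ)) ≤ fromℕ 2 ^ (16 ℕ.∸ m) * (+ 5 / 2) ^ k
pairSum-weights {zero}  m p p↑ m≤p = subst (1ℚ ≤_) (sym (*-identityʳ _)) (1≤2^ (16 ℕ.∸ m))
  where
  1≤2^ : ∀ n → 1ℚ ≤ fromℕ 2 ^ n
  1≤2^ zero    = ≤-refl
  1≤2^ (suc n) = *-mono {1ℚ} {fromℕ 2} {1ℚ} (≤ᵇ⇒≤ _) (≤ᵇ⇒≤ _) (≤ᵇ⇒≤ _) (1≤2^ n)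
pairSum-weights {suc k} m p p↑ m≤p = begin
  pairSum (suc k) (λ ε δ → recip (weights p ε δ))
    ≡⟨ pairSum-suc (λ ε δ → recip (weights p ε δ)) ⟩
  _ ≡⟨ cong₂ _+_ (cong₂ _+_ (term zero zero) (term zero (suc zero)))
                 (cong₂ _+_ (term (suc zero) zero) (term (suc zero) (suc zero))) ⟩
  1ℚ * R + r * R + (r * R + 1ℚ * R)
    ≡⟨ solve 2 (λ r R → con 1ℚ :* R :+ r :* R :+ (r :* R :+ con 1ℚ :* R) := (con 1ℚ :+ r :+ (r :+ con 1ℚ)) :* R) refl r R ⟩
  (1ℚ + r + (r + 1ℚ)) * R
    ≤⟨ *-monoʳ (0≤+ (0≤+ 0≤1 0≤r) (0≤+ 0≤r 0≤1)) IH ⟩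
  (1ℚ + r + (r + 1ℚ)) * (fromℕ 2 ^ (16 ℕ.∸ suc m) * (+ 5 / 2) ^ k)
    ≤⟨ step ⟩
  fromℕ 2 ^ (16 ℕ.∸ m) * (+ 5 / 2) ^ suc k ∎
  where
  open ≤-Reasoning
  open +-*-Solver
  r = recip (big (p zero))
  R = pairSum k (λ ε δ → recip (weights (p ∘ suc) ε δ))
  0≤r = 0≤recip (big (p zero))
  0≤1 : 0ℚ ≤ 1ℚ
  0≤1 = ≤ᵇ⇒≤ _
  term : ∀ i j → pairSum k (λ ε δ → recip (weights p (i ∷ ε) (j ∷ δ))) ≡ recip (weight (p zero) i j) * R
  term i j = trans
    (pairSum-cong λ ε δ → recip-* (weight (p zero) i j) (weights (p ∘ suc) ε δ)
      {{weight-nonZero (p zero) i j}} {{weights-nonZero (p ∘ suc) ε δ}})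
    (pairSum-distribˡ-* (recip (weight (p zero) i j)) (λ ε δ → recip (weights (p ∘ suc) ε δ)))
  -- By strict increase the lower bound on the entries rises by at least one with each tail, so 16 ∸
  -- m limits how many entries below 16 can still follow.
  IH = pairSum-weights (suc m) (p ∘ suc) (λ i j i<j → p↑ (suc i) (suc j) (s≤s i<j))
    (λ i → ℕ.≤-<-trans (m≤p zero) (p↑ zero (suc i) z<s))
  step : (1ℚ + r + (r + 1ℚ)) * (fromℕ 2 ^ (16 ℕ.∸ suc m) * (+ 5 / 2) ^ k) ≤ fromℕ 2 ^ (16 ℕ.∸ m) * (+ 5 / 2) ^ suc k
  step with 16 ℕ.≤? p zero
  -- Here r is ¼, and the local factor evaluates to 5/2.
  ... | yes _ = begin
    (+ 5 / 2) * (fromℕ 2 ^ (16 ℕ.∸ suc m) * (+ 5 / 2) ^ k)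
      ≡⟨ solve 3 (λ a b c → a :* (b :* c) := b :* (a :* c)) refl (+ 5 / 2) (fromℕ 2 ^ (16 ℕ.∸ suc m)) ((+ 5 / 2) ^ k) ⟩
    fromℕ 2 ^ (16 ℕ.∸ suc m) * (+ 5 / 2) ^ suc k
      ≤⟨ *-monoˡ (0≤^ {+ 5 / 2} (suc k) (≤ᵇ⇒≤ _)) (2^-mono (ℕ.∸-monoʳ-≤ 16 (ℕ.n≤1+n m))) ⟩
    fromℕ 2 ^ (16 ℕ.∸ m) * (+ 5 / 2) ^ suc k ∎
    where
    2^-mono : ∀ {i j} → i ℕ.≤ j → fromℕ 2 ^ i ≤ fromℕ 2 ^ j
    2^-mono {j = zero}  z≤n       = ≤-refl
    2^-mono {j = suc j} z≤n       = *-mono {1ℚ} {fromℕ 2} {1ℚ} (≤ᵇ⇒≤ _) (≤ᵇ⇒≤ _) (≤ᵇ⇒≤ _) (2^-mono {j = j} z≤n)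
    2^-mono             (s≤s i≤j) = *-monoʳ {fromℕ 2} (≤ᵇ⇒≤ _) (2^-mono i≤j)
  -- A small entry forces m ≤ 15, so 16 ∸ m is a successor and releases a factor 2. The local factor
  -- is 4, which is at most 2 · 5/2.
  ... | no p₀<16 rewrite ℕ.+-∸-assoc 1 {15} {m} (ℕ.s≤s⁻¹ (ℕ.≤-<-trans (m≤p zero) (ℕ.≰⇒> p₀<16))) = begin
    fromℕ 4 * (fromℕ 2 ^ (15 ℕ.∸ m) * (+ 5 / 2) ^ k)
      ≤⟨ *-monoˡ {p = fromℕ 4} {q = fromℕ 2 * (+ 5 / 2)}
           (0≤* (0≤^ {fromℕ 2} (15 ℕ.∸ m) (≤ᵇ⇒≤ _)) (0≤^ {+ 5 / 2} k (≤ᵇ⇒≤ _))) (≤ᵇ⇒≤ _) ⟩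
    fromℕ 2 * (+ 5 / 2) * (fromℕ 2 ^ (15 ℕ.∸ m) * (+ 5 / 2) ^ k)
      ≡⟨ solve 4 (λ a b c d → a :* b :* (c :* d) := a :* c :* (b :* d)) refl (fromℕ 2) (+ 5 / 2) (fromℕ 2 ^ (15 ℕ.∸ m)) ((+ 5 / 2) ^ k) ⟩
    fromℕ 2 * fromℕ 2 ^ (15 ℕ.∸ m) * ((+ 5 / 2) * (+ 5 / 2) ^ k) ∎

N≤[5/2]^k : ∀ b (p : Vector ℕ k) → AllPrime p → StrictlyIncreasing p →
  fromℕ (N b (F p)) ≤ fromℕ b * (fromℕ 2 ^ 16 * (+ 5 / 2) ^ k)
N≤[5/2]^k {k} b p pp p↑ = begin
  fromℕ (N b (F p))
    ≡⟨ N≡pairSum b p pp p! ⟩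
  pairSum k (λ ε δ → fromℕ (count b (monomial p ε) (monomial p δ)))
    ≤⟨ pairSum-mono (λ ε δ → *≤⇒≤*recip {count b (monomial p ε) (monomial p δ)} (weights p ε δ) {{weights-nonZero p ε δ}}
         (count*weight≤ b {{monomial-nonZero p pp ε}} {{monomial-nonZero p pp δ}} (monomial-coprimeParts p pp p! ε δ))) ⟩
  pairSum k (λ ε δ → fromℕ b * recip (weights p ε δ))
    ≡⟨ pairSum-distribˡ-* (fromℕ b) (λ ε δ → recip (weights p ε δ)) ⟩
  fromℕ b * pairSum k (λ ε δ → recip (weights p ε δ))
    ≤⟨ *-monoʳ (0≤fromℕ b) (pairSum-weights 0 p p↑ (λ _ → z≤n)) ⟩
  fromℕ b * (fromℕ 2 ^ 16 * (+ 5 / 2) ^ k) ∎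
  where
  open ≤-Reasoning
  p! = StrictlyIncreasing⇒Distinct p↑

fromℕ-^ : ∀ m n → fromℕ (m ℕ.^ n) ≡ fromℕ m ^ n
fromℕ-^ m zero    = refl
fromℕ-^ m (suc n) = trans (fromℕ-* m (m ℕ.^ n)) (cong (fromℕ m *_) (fromℕ-^ m n))

N≤b²2^k : ∀ b (p : Vector ℕ k) → AllPrime p → Distinct p →
  fromℕ (N b (F p)) ≤ fromℕ b * (fromℕ 2 ^ k * fromℕ b)
N≤b²2^k {k} b p pp p! = begin
  fromℕ (N b (F p))                     ≤⟨ fromℕ-mono (subst (λ S → N b S ℕ.≤ b ℕ.* (length S ℕ.* b)) (sym (F≡map p pp p!))
                                             (N≤ b (Unique.map⁺ (monomial-injective p pp p!) (exponents-unique k)))) ⟩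
  fromℕ (b ℕ.* (length (F p) ℕ.* b))    ≡⟨ trans (fromℕ-* b _) (cong (fromℕ b *_) (fromℕ-* (length (F p)) b)) ⟩
  fromℕ b * (fromℕ (length (F p)) * fromℕ b)
    ≡⟨ cong (λ n → fromℕ b * (n * fromℕ b)) (trans (cong fromℕ length-F) (fromℕ-^ 2 k)) ⟩
  fromℕ b * (fromℕ 2 ^ k * fromℕ b)     ∎
  where
  open ≤-Reasoning
  length-F : length (F p) ≡ 2 ℕ.^ k
  length-F = trans (cong length (F≡map p pp p!)) (trans (length-map (monomial p) (exponents k)) (length-exponents k))

-- Lower bounds

-- A stand-in for `ω` of the monomial that unfolds along the exponent vector.
size : Vec (Fin 2) k → ℕ
size []             = 0
size (zero ∷ ε)     = size ε
size (suc zero ∷ ε) = suc (size ε)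

length-support : (p : Vector ℕ k) → ∀ ε → length (support p ε) ≡ size ε
length-support p []             = refl
length-support p (zero ∷ ε)     = length-support (p ∘ suc) ε
length-support p (suc zero ∷ ε) = cong suc (length-support (p ∘ suc) ε)

size≤ω : (p : Vector ℕ k) → AllPrime p → Distinct p → ∀ ε → size ε ℕ.≤ ω (monomial p ε)
size≤ω p pp p! ε = subst (ℕ._≤ ω (monomial p ε)) (length-support p ε) (length-support≤ω p pp p! ε)

-- atDifference ε δ h is h (δ - ε) if ε ≤ δ coordinatewise, and 0 otherwise.
atDifference : Vec (Fin 2) k → Vec (Fin 2) k → (Vec (Fin 2) k → ℚ) → ℚ
atDifference []             []             h = h []
atDifference (zero ∷ ε)     (zero ∷ δ)     h = atDifference ε δ (h ∘ (zero ∷_))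
atDifference (zero ∷ ε)     (suc zero ∷ δ) h = atDifference ε δ (h ∘ (suc zero ∷_))
atDifference (suc zero ∷ ε) (zero ∷ δ)     h = 0ℚ
atDifference (suc zero ∷ ε) (suc zero ∷ δ) h = atDifference ε δ (h ∘ (zero ∷_))

-- For a given β there are 2^(k - |β|) pairs ε ≤ δ with δ - ε = β.
pairSum-atDifference : ∀ k (h : Vec (Fin 2) k → ℚ) →
  pairSum k (λ ε δ → atDifference ε δ h) ≡ fromℕ 2 ^ k * ∑ (exponents k) (λ β → ½ ^ size β * h β)
pairSum-atDifference zero    h = solve 1 (λ x → x :+ con 0ℚ :+ con 0ℚ := con 1ℚ :* (con 1ℚ :* x :+ con 0ℚ)) refl (h [])
  where open +-*-Solver
pairSum-atDifference (suc k) h = begin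
  pairSum (suc k) (λ ε δ → atDifference ε δ h)
    ≡⟨ pairSum-suc (λ ε δ → atDifference ε δ h) ⟩
  pairSum k (λ ε δ → atDifference ε δ h₀) + pairSum k (λ ε δ → atDifference ε δ h₁)
    + (pairSum k (λ ε δ → 0ℚ) + pairSum k (λ ε δ → atDifference ε δ h₀))
    ≡⟨ cong₂ _+_ (cong₂ _+_ (pairSum-atDifference k h₀) (pairSum-atDifference k h₁))
         (cong₂ _+_ (trans (∑-cong es (λ _ → ∑-zero es)) (∑-zero es)) (pairSum-atDifference k h₀)) ⟩
  -- Equal first exponents give difference 0 in two ways, (0, 1) gives difference 1 in one way, and
  -- (1, 0) contributes nothing: 2 S₀ + S₁ = 2 (S₀ + ½ S₁).
  2^k * S₀ + 2^k * S₁ + (0ℚ + 2^k * S₀)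
    ≡⟨ solve 3 (λ t x y → t :* x :+ t :* y :+ (con 0ℚ :+ t :* x) := con (fromℕ 2) :* t :* (x :+ con ½ :* y))
         refl 2^k S₀ S₁ ⟩
  fromℕ 2 * 2^k * (S₀ + ½ * S₁)
    ≡⟨ cong (λ s → fromℕ 2 * 2^k * (S₀ + s)) (∑-distribˡ-* ½ es (λ β → ½ ^ size β * h₁ β)) ⟨
  fromℕ 2 * 2^k * (S₀ + ∑ es (λ β → ½ * (½ ^ size β * h₁ β)))
    ≡⟨ cong (λ s → fromℕ 2 * 2^k * (S₀ + s)) (∑-cong es (λ β → *-assoc ½ (½ ^ size β) (h₁ β))) ⟨
  fromℕ 2 * 2^k * (S₀ + ∑ es (λ β → ½ * ½ ^ size β * h₁ β))
    ≡⟨ cong (fromℕ 2 * 2^k *_) (∑-exponents k (λ β → ½ ^ size β * h β)) ⟨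
  fromℕ 2 * 2^k * ∑ (exponents (suc k)) (λ β → ½ ^ size β * h β) ∎
  where
  open ≡-Reasoning
  open +-*-Solver
  es = exponents k
  2^k = fromℕ 2 ^ k
  h₀ = h ∘ (zero ∷_)
  h₁ = h ∘ (suc zero ∷_)
  S₀ = ∑ es (λ β → ½ ^ size β * h₀ β)
  S₁ = ∑ es (λ β → ½ ^ size β * h₁ β)

-- The function `h` stays quantified because the recursion of `atDifference` changes it at every
-- coordinate. In the first case n₄ = n₂ · n, with n the monomial of β.
DifferenceCases : Vector ℕ k → Vec (Fin 2) k → Vec (Fin 2) k → Set
DifferenceCases p ε δ =
  (∃[ β ] (∀ h → atDifference ε δ h ≡ h β) × monomial p δ ≡ monomial p ε ℕ.* monomial p β)
  ⊎ (∀ h → atDifference ε δ h ≡ 0ℚ)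

atDifference-cases : (p : Vector ℕ k) → ∀ ε δ → DifferenceCases p ε δ
atDifference-cases p []             []             = inj₁ ([] , (λ _ → refl) , refl)
atDifference-cases p (suc zero ∷ ε) (zero ∷ δ)     = inj₂ (λ _ → refl)
atDifference-cases p (zero ∷ ε)     (zero ∷ δ)     with atDifference-cases (p ∘ suc) ε δ
... | inj₂ 0≡            = inj₂ (λ h → 0≡ _)
... | inj₁ (β , eq , m≡) = inj₁ (zero ∷ β , (λ h → eq _) , trans (cong (1 ℕ.*_) m≡)
  (solve 2 (λ x y → con 1 :* (x :* y) := con 1 :* x :* (con 1 :* y)) refl (monomial (p ∘ suc) ε) (monomial (p ∘ suc) β)))
  where open ℕSolver.+-*-Solver
atDifference-cases p (zero ∷ ε)     (suc zero ∷ δ) with atDifference-cases (p ∘ suc) ε δ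
... | inj₂ 0≡            = inj₂ (λ h → 0≡ _)
... | inj₁ (β , eq , m≡) = inj₁ (suc zero ∷ β , (λ h → eq _) , trans (cong (p zero ℕ.^ 1 ℕ.*_) m≡)
  (solve 3 (λ q x y → q :* (x :* y) := con 1 :* x :* (q :* y)) refl (p zero ℕ.^ 1) (monomial (p ∘ suc) ε) (monomial (p ∘ suc) β)))
  where open ℕSolver.+-*-Solver
atDifference-cases p (suc zero ∷ ε) (suc zero ∷ δ) with atDifference-cases (p ∘ suc) ε δ
... | inj₂ 0≡            = inj₂ (λ h → 0≡ _)
... | inj₁ (β , eq , m≡) = inj₁ (zero ∷ β , (λ h → eq _) , trans (cong (p zero ℕ.^ 1 ℕ.*_) m≡)
  (solve 3 (λ q x y → q :* (x :* y) := q :* x :* (con 1 :* y)) refl (p zero ℕ.^ 1) (monomial (p ∘ suc) ε) (monomial (p ∘ suc) β)))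
  where open ℕSolver.+-*-Solver

-- The cutoff n ≤ b is the range where x = b / n is at least 1, so that x ≤ 2⌊x⌋ applies.
truncatedRecip : ℕ → ℕ → ℚ
truncatedRecip b n = indicator (n ≤? b) * recip n

*truncatedRecip≤ : ∀ {c} b n .{{_ : ℕ.NonZero n}} → (n ℕ.≤ b → b ℕ.≤ c ℕ.* n) →
  fromℕ b * truncatedRecip b n ≤ fromℕ c
*truncatedRecip≤ {c} b n b≤cn with n ≤? b
... | yes n≤b = subst (λ r → fromℕ b * r ≤ fromℕ c) (sym (*-identityˡ (recip n))) (≤*⇒*recip≤ {c} {b} n (b≤cn n≤b))
... | no _    = subst (_≤ fromℕ c) (sym (trans (cong (fromℕ b *_) (*-zeroˡ (recip n))) (*-zeroʳ (fromℕ b)))) (0≤fromℕ c)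

-- x ≤ 2 ⌊x⌋ for x ≥ 1.
*truncatedRecip≤2⌊⌋ : ∀ b n .{{_ : ℕ.NonZero n}} →
  fromℕ b * truncatedRecip b n ≤ fromℕ (b ℕ./ n ℕ.+ b ℕ./ n)
*truncatedRecip≤2⌊⌋ b n = *truncatedRecip≤ {b ℕ./ n ℕ.+ b ℕ./ n} b n λ n≤b → begin
  b                                   ≡⟨ m≡m%n+[m/n]*n b n ⟩
  b ℕ.% n ℕ.+ b ℕ./ n ℕ.* n           ≤⟨ ℕ.+-monoˡ-≤ _ (ℕ.<⇒≤ (m%n<n b n)) ⟩
  n ℕ.+ b ℕ./ n ℕ.* n                 ≤⟨ ℕ.+-monoˡ-≤ _ (ℕ.m≤n*m n (b ℕ./ n) {{ℕ.>-nonZero (m≥n⇒m/n>0 n≤b)}}) ⟩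
  b ℕ./ n ℕ.* n ℕ.+ b ℕ./ n ℕ.* n     ≡⟨ ℕ.*-distribʳ-+ n (b ℕ./ n) (b ℕ./ n) ⟨
  (b ℕ./ n ℕ.+ b ℕ./ n) ℕ.* n         ∎
  where open ℕ.≤-Reasoning

-- One floor comes from the pair (x, y), the other from its mirror image (y, x).
*truncatedRecip≤count+count : ∀ b {x y} n .{{_ : ℕ.NonZero n}} → y ≡ x ℕ.* n →
  fromℕ b * truncatedRecip b n ≤ fromℕ (count b x y) + fromℕ (count b y x)
*truncatedRecip≤count+count b {x} {y} n refl = begin
  fromℕ b * truncatedRecip b n              ≤⟨ *truncatedRecip≤2⌊⌋ b n ⟩
  fromℕ (b ℕ./ n ℕ.+ b ℕ./ n)
    ≤⟨ fromℕ-mono (ℕ.+-mono-≤ (count≥/ b x n) (ℕ.≤-trans (count≥/ b x n) (count-swap b x y))) ⟩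
  fromℕ (count b x y ℕ.+ count b y x)       ≡⟨ fromℕ-+ (count b x y) (count b y x) ⟩
  fromℕ (count b x y) + fromℕ (count b y x) ∎
  where open ≤-Reasoning

-- At n = 1 the floor is exact, so a single count suffices; this serves the diagonal.
*truncatedRecip1≤count : ∀ b {x y n} .{{_ : ℕ.NonZero n}} → y ≡ x ℕ.* n → n ≡ 1 →
  fromℕ b * truncatedRecip b n ≤ fromℕ (count b x y)
*truncatedRecip1≤count b {x} {y} refl refl = *truncatedRecip≤ {count b x y} b 1 λ _ →
  ℕ.≤-trans (ℕ.≤-reflexive (sym (m/n*n≡m (1∣ b)))) (ℕ.*-monoˡ-≤ 1 (count≥/ b x 1))

-- The common source of both lower bounds: it dominates 1 plus the stated sum over F, and also the
-- product over primes if F lies in [1, B].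
weightedSum : ℕ → Vector ℕ k → ℚ
weightedSum {k} b p = ∑ (exponents k) λ β → ½ ^ size β * truncatedRecip b (monomial p β)

-- The pairs ε < δ carry a weight exceeding their count by a factor of at most 2,
-- which is made up for by the pairs δ < ε; so the comparison is symmetrised.
N≥weightedSum : ∀ b (p : Vector ℕ k) → AllPrime p → Distinct p →
  fromℕ 2 ^ k * fromℕ b * weightedSum b p ≤ fromℕ (N b (F p))
N≥weightedSum {k} b p pp p! = begin
  fromℕ 2 ^ k * fromℕ b * weightedSum b p
    ≡⟨ *-assoc (fromℕ 2 ^ k) (fromℕ b) (weightedSum b p) ⟩
  fromℕ 2 ^ k * (fromℕ b * weightedSum b p)
    ≡⟨ cong (fromℕ 2 ^ k *_) (∑-distribˡ-* (fromℕ b) (exponents k) (λ β → ½ ^ size β * truncatedRecip b (monomial p β))) ⟨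
  fromℕ 2 ^ k * ∑ (exponents k) (λ β → fromℕ b * (½ ^ size β * truncatedRecip b (monomial p β)))
    ≡⟨ cong (fromℕ 2 ^ k *_) (∑-cong (exponents k) λ β →
         solve 3 (λ x y z → x :* (y :* z) := y :* (x :* z)) refl (fromℕ b) (½ ^ size β) (truncatedRecip b (monomial p β))) ⟩
  fromℕ 2 ^ k * ∑ (exponents k) (λ β → ½ ^ size β * h β)
    ≡⟨ pairSum-atDifference k h ⟨
  pairSum k (λ ε δ → atDifference ε δ h)
    ≤⟨ double-cancel doubled ⟩
  pairSum k c
    ≡⟨ N≡pairSum b p pp p! ⟨
  fromℕ (N b (F p)) ∎
  where
  open ≤-Reasoning
  open +-*-Solver
  h : Vec (Fin 2) k → ℚ
  h β = fromℕ b * truncatedRecip b (monomial p β)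
  c : Vec (Fin 2) k → Vec (Fin 2) k → ℚ
  c ε δ = fromℕ (count b (monomial p ε) (monomial p δ))
  m≢0 = monomial-nonZero p pp
  double-cancel : ∀ {x y} → x + x ≤ y + y → x ≤ y
  double-cancel 2x≤2y = ≮⇒≥ λ y<x → <-irrefl refl (<-≤-trans (+-mono-< y<x y<x) 2x≤2y)
  pair : ∀ ε δ → DifferenceCases p ε δ → DifferenceCases p δ ε →
    atDifference ε δ h + atDifference δ ε h ≤ c ε δ + c δ ε
  pair ε δ (inj₂ 0≡) (inj₂ 0≡′) = begin
    atDifference ε δ h + atDifference δ ε h   ≡⟨ cong₂ _+_ (0≡ h) (0≡′ h) ⟩
    0ℚ + 0ℚ                                   ≤⟨ +-mono-≤ (0≤fromℕ (count b (monomial p ε) (monomial p δ)))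
                                                          (0≤fromℕ (count b (monomial p δ) (monomial p ε))) ⟩
    c ε δ + c δ ε                             ∎
  pair ε δ (inj₁ (β , eq , m≡)) (inj₂ 0≡′) = begin
    atDifference ε δ h + atDifference δ ε h   ≡⟨ cong₂ _+_ (eq h) (0≡′ h) ⟩
    h β + 0ℚ                                  ≡⟨ +-identityʳ (h β) ⟩
    h β                                       ≤⟨ *truncatedRecip≤count+count b (monomial p β) {{m≢0 β}} m≡ ⟩
    c ε δ + c δ ε                             ∎
  pair ε δ (inj₂ 0≡) (inj₁ (β , eq , m≡)) = begin
    atDifference ε δ h + atDifference δ ε h   ≡⟨ cong₂ _+_ (0≡ h) (eq h) ⟩
    0ℚ + h β                                  ≡⟨ +-identityˡ (h β) ⟩
    h β                                       ≤⟨ *truncatedRecip≤count+count b (monomial p β) {{m≢0 β}} m≡ ⟩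
    c δ ε + c ε δ                             ≡⟨ +-comm (c δ ε) (c ε δ) ⟩
    c ε δ + c δ ε                             ∎
  -- Each monomial divides the other, so the two quotients have product 1 and both equal 1.
  pair ε δ (inj₁ (β , eq , m≡)) (inj₁ (β′ , eq′ , m≡′)) = begin
    atDifference ε δ h + atDifference δ ε h   ≡⟨ cong₂ _+_ (eq h) (eq′ h) ⟩
    h β + h β′                                ≤⟨ +-mono-≤
      (*truncatedRecip1≤count b {{m≢0 β}} m≡ (ℕ.m*n≡1⇒m≡1 (monomial p β) (monomial p β′) ββ′≡1))
      (*truncatedRecip1≤count b {{m≢0 β′}} m≡′ (ℕ.m*n≡1⇒n≡1 (monomial p β) (monomial p β′) ββ′≡1)) ⟩
    c ε δ + c δ ε                             ∎
    where
    ββ′≡1 : monomial p β ℕ.* monomial p β′ ≡ 1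
    ββ′≡1 = ℕ.*-cancelˡ-≡ (monomial p β ℕ.* monomial p β′) 1 (monomial p ε) {{m≢0 ε}} (trans (sym (ℕ.*-assoc (monomial p ε) (monomial p β) (monomial p β′)))
      (trans (cong (ℕ._* monomial p β′) (sym m≡)) (trans (sym m≡′) (sym (ℕ.*-identityʳ (monomial p ε))))))
  doubled : pairSum k (λ ε δ → atDifference ε δ h) + pairSum k (λ ε δ → atDifference ε δ h) ≤ pairSum k c + pairSum k c
  doubled = subst₂ _≤_ (pairSum-+-flip (λ ε δ → atDifference ε δ h)) (pairSum-+-flip c) (pairSum-mono λ ε δ → pair ε δ (atDifference-cases p ε δ) (atDifference-cases p δ ε))

-- From the weighted sum to the stated sum and the Euler product

½^-antimono : ∀ {m n} → m ℕ.≤ n → ½ ^ n ≤ ½ ^ m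
½^-antimono {n = zero}  z≤n       = ≤-refl
½^-antimono {n = suc n} z≤n       = *-mono {½} {1ℚ} {½ ^ n} (≤ᵇ⇒≤ _) (0≤^ {½} n (≤ᵇ⇒≤ _)) (≤ᵇ⇒≤ _) (½^-antimono {n = n} z≤n)
½^-antimono             (s≤s m≤n) = *-monoʳ {½} (≤ᵇ⇒≤ _) (½^-antimono m≤n)

-- Isolates the zero vector, that is n = 1, which the stated sum excludes and which yields the
-- leading term 2ᵏB.
exponents-head : ∀ k → ∃[ εs ] exponents k ≡ Vec.replicate k zero ∷ εs
exponents-head zero    = [] , refl
exponents-head (suc k) with exponents k | exponents-head k
... | _ | εs , refl = _ , refl

monomial-zeros : (p : Vector ℕ k) → monomial p (Vec.replicate k zero) ≡ 1
monomial-zeros {zero}  p = refl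
monomial-zeros {suc k} p = cong (1 ℕ.*_) (monomial-zeros (p ∘ suc))

size-zeros : ∀ k → size (Vec.replicate k zero) ≡ 0
size-zeros zero    = refl
size-zeros (suc k) = size-zeros k

1<n≤b? : ∀ b n → Dec (1 ℕ.< n × n ℕ.≤ b)
1<n≤b? b n = (1 <? n) ×-dec (n ≤? b)

properDivisorSum≤ : ∀ b (p : Vector ℕ k) → AllPrime p → Distinct p → 1 ℕ.≤ b →
  1ℚ + ∑ (filter (1<n≤b? b) (F p)) (λ n → ½ ^ ω n * recip n) ≤ weightedSum b p
properDivisorSum≤ {k} b p pp p! 1≤b = begin
  1ℚ + ∑ (filter (1<n≤b? b) (F p)) f
    ≡⟨ cong (_+_ 1ℚ) (trans (∑-filter (1<n≤b? b) (F p) f)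
         (trans (cong (λ xs → ∑ xs g) (F≡map p pp p!)) (∑-map (exponents k) (monomial p) g))) ⟩
  1ℚ + ∑ (exponents k) (g ∘ monomial p)
    ≡⟨ cong (λ es → 1ℚ + ∑ es (g ∘ monomial p)) exponents≡ ⟩
  1ℚ + (g (monomial p zeros) + ∑ εs (g ∘ monomial p))
    ≡⟨ +-assoc 1ℚ (g (monomial p zeros)) (∑ εs (g ∘ monomial p)) ⟨
  1ℚ + g (monomial p zeros) + ∑ εs (g ∘ monomial p)
    ≤⟨ +-mono-≤ (head≤ (monomial-zeros p) (size-zeros k))
         (∑-mono εs λ β → drop-1< (monomial p β) (size β) (size≤ω p pp p! β)) ⟩
  h zeros + ∑ εs h
    ≡⟨ cong (λ es → ∑ es h) exponents≡ ⟨
  weightedSum b p ∎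
  where
  open ≤-Reasoning
  f g : ℕ → ℚ
  f n = ½ ^ ω n * recip n
  g n = indicator (1<n≤b? b n) * f n
  h : Vec (Fin 2) k → ℚ
  h β = ½ ^ size β * truncatedRecip b (monomial p β)
  drop-1< : ∀ n s → s ℕ.≤ ω n → g n ≤ ½ ^ s * truncatedRecip b n
  drop-1< n s s≤ω = begin
    indicator (1<n≤b? b n) * f n
      ≤⟨ *-mono (0≤indicator (n ≤? b)) (0≤* (0≤^ {½} (ω n) (≤ᵇ⇒≤ _)) (0≤recip n))
           (indicator-mono (1<n≤b? b n) (n ≤? b) proj₂) (*-monoˡ (0≤recip n) (½^-antimono s≤ω)) ⟩
    indicator (n ≤? b) * (½ ^ s * recip n)
      ≡⟨ solve 3 (λ i h r → i :* (h :* r) := h :* (i :* r)) refl (indicator (n ≤? b)) (½ ^ s) (recip n) ⟩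
    ½ ^ s * truncatedRecip b n ∎
    where open +-*-Solver
  -- The indicator of 1 < 1 removes n = 1 from the stated sum, so the separate summand 1 takes its
  -- place; B ≥ 1 keeps n = 1 within the cutoff.
  head≤ : ∀ {n s} → n ≡ 1 → s ≡ 0 → 1ℚ + g n ≤ ½ ^ s * truncatedRecip b n
  head≤ refl refl = begin
    1ℚ + g 1                              ≡⟨ cong (λ i → 1ℚ + i * f 1) (indicator-false (1<n≤b? b 1) λ (1<1 , _) → ℕ.<-irrefl refl 1<1) ⟩
    1ℚ + 0ℚ * f 1                         ≡⟨ cong (_+_ 1ℚ) (*-zeroˡ (f 1)) ⟩
    ½ ^ 0 * (1ℚ * recip 1)                ≡⟨ cong (λ i → ½ ^ 0 * (i * recip 1)) (indicator-true (1 ≤? b) 1≤b) ⟨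
    ½ ^ 0 * truncatedRecip b 1            ∎
  zeros = Vec.replicate k zero
  εs = proj₁ (exponents-head k)
  exponents≡ = proj₂ (exponents-head k)

-- Expanding the product, the choice β of factors contributes the product of the chosen 1/(2p),
-- which is 2^(-|β|) over the monomial.
∑½^size*recip≡∏ : (p : Vector ℕ k) → AllPrime p →
  ∑ (exponents k) (λ β → ½ ^ size β * recip (monomial p β)) ≡ ∏ (λ j → 1ℚ + recip (2 ℕ.* p j))
∑½^size*recip≡∏ {zero}  p pp = refl
∑½^size*recip≡∏ {suc k} p pp = begin
  ∑ (exponents (suc k)) (λ β → ½ ^ size β * recip (monomial p β))
    ≡⟨ ∑-exponents k (λ β → ½ ^ size β * recip (monomial p β)) ⟩
  ∑ es (λ β → ½ ^ size β * recip (1 ℕ.* m β)) + ∑ es (λ β → ½ * ½ ^ size β * recip (p zero ℕ.^ 1 ℕ.* m β))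
    ≡⟨ cong₂ _+_ (∑-cong es λ β → cong (λ n → ½ ^ size β * recip n) (ℕ.*-identityˡ (m β)))
         (trans (∑-cong es term) (∑-distribˡ-* (recip (2 ℕ.* p zero)) es (λ β → ½ ^ size β * recip (m β)))) ⟩
  S + recip (2 ℕ.* p zero) * S
    ≡⟨ solve 2 (λ r s → s :+ r :* s := (con 1ℚ :+ r) :* s) refl (recip (2 ℕ.* p zero)) S ⟩
  (1ℚ + recip (2 ℕ.* p zero)) * S
    ≡⟨ cong ((1ℚ + recip (2 ℕ.* p zero)) *_) (∑½^size*recip≡∏ (p ∘ suc) (pp ∘ suc)) ⟩
  (1ℚ + recip (2 ℕ.* p zero)) * ∏ (λ j → 1ℚ + recip (2 ℕ.* p (suc j))) ∎
  where
  open ≡-Reasoning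
  open +-*-Solver
  es = exponents k
  m = monomial (p ∘ suc)
  S = ∑ es (λ β → ½ ^ size β * recip (m β))
  instance
    p₀≢0 : ℕ.NonZero (p zero)
    p₀≢0 = prime⇒nonZero (pp zero)
  term : ∀ β → ½ * ½ ^ size β * recip (p zero ℕ.^ 1 ℕ.* m β) ≡ recip (2 ℕ.* p zero) * (½ ^ size β * recip (m β))
  term β = begin
    ½ * ½ ^ size β * recip (p zero ℕ.^ 1 ℕ.* m β)
      ≡⟨ cong (λ n → ½ * ½ ^ size β * recip (n ℕ.* m β)) (ℕ.^-identityʳ (p zero)) ⟩
    ½ * ½ ^ size β * recip (p zero ℕ.* m β)
      ≡⟨ cong (½ * ½ ^ size β *_) (recip-* (p zero) (m β) {{p₀≢0}} {{monomial-nonZero (p ∘ suc) (pp ∘ suc) β}}) ⟩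
    ½ * ½ ^ size β * (recip (p zero) * recip (m β))
      ≡⟨ solve 4 (λ a b c d → a :* b :* (c :* d) := a :* c :* (b :* d)) refl ½ (½ ^ size β) (recip (p zero)) (recip (m β)) ⟩
    ½ * recip (p zero) * (½ ^ size β * recip (m β))
      ≡⟨ cong (_* (½ ^ size β * recip (m β))) (recip-* 2 (p zero)) ⟨
    recip (2 ℕ.* p zero) * (½ ^ size β * recip (m β)) ∎

monomial∈F : (p : Vector ℕ k) → AllPrime p → Distinct p → ∀ {β} → β ∈ exponents k → monomial p β ∈ F p
monomial∈F p pp p! {β} β∈ = subst (monomial p β ∈_) (sym (F≡map p pp p!)) (∈-map⁺ (monomial p) β∈)

-- When F lies below b no term is cut off, and the whole Euler product remains.
weightedSum≥∏ : ∀ b (p : Vector ℕ k) → AllPrime p → Distinct p →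
  (∀ {n} → n ∈ F p → n ℕ.≤ b) → ∏ (λ j → 1ℚ + recip (2 ℕ.* p j)) ≤ weightedSum b p
weightedSum≥∏ {k} b p pp p! F≤b = subst (_≤ weightedSum b p) (∑½^size*recip≡∏ p pp)
  (∑-mono-∈ (exponents k) λ {β} β∈ → *-monoʳ (0≤^ {½} (size β) (≤ᵇ⇒≤ _)) (recip≤ (F≤b (monomial∈F p pp p! β∈))))
  where
  recip≤ : ∀ {n} → n ℕ.≤ b → recip n ≤ truncatedRecip b n
  recip≤ {n} n≤b = ≤-reflexive (sym
    (trans (cong (_* recip n) (indicator-true (n ≤? b) n≤b)) (*-identityˡ (recip n))))

-- The minimum in the upper bound, and the three inequalities

≤*⊓ : ∀ {x r a b} → x ≤ r * a → x ≤ r * b → x ≤ r * (a ⊓ b)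
≤*⊓ {x} {r} {a} {b} x≤ra x≤rb with ≤-total a b
... | inj₁ a≤b = subst (λ m → x ≤ r * m) (sym (p≤q⇒p⊓q≡p a≤b)) x≤ra
... | inj₂ b≤a = subst (λ m → x ≤ r * m) (sym (p≥q⇒p⊓q≡q b≤a)) x≤rb

theorem1p4 : ∃[ C ] 0ℚ < C ×
    (∀ (k : ℕ) → 1 ℕ.≤ k →
    ∀ (p : Vector ℕ k) → (∀ i → Prime (p i)) → (∀ i j → i Fin.< j → p i ℕ.< p j) →
    ∀ (B : ℕ) → 1 ℕ.≤ B →
    (fromℕ (N B (F p))
    ≤ C * fromℕ B * fromℕ 2 ^ k * ∏ (λ i → 1ℚ + recip (4 ℕ.* p i))
    * (fromℕ B ⊓ (+ 5 / 4) ^ k)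
    + C * fromℕ 2 ^ k * ∏ (λ i → 1ℚ + recip (3 ℕ.* p i))
    * ((fromℕ B * (+ 3 / 2) ^ k) ⊓ fromℕ 2 ^ k))
    × (fromℕ 2 ^ k * fromℕ B
    + fromℕ 2 ^ k * fromℕ B
    * ∑ (filter (λ n → (1 <? n) ×-dec (n ≤? B)) (F p)) (λ n → ½ ^ ω n * recip n)
    ≤ fromℕ (N B (F p)))
    × ((∀ {n} → n ∈ F p → 1 ℕ.≤ n × n ℕ.≤ B) →
    fromℕ 2 ^ k * fromℕ B * ∏ (λ j → 1ℚ + recip (2 ℕ.* p j))
    ≤ fromℕ (N B (F p))))
theorem1p4 = C , 0<C , λ k _ p pp p↑ B 1≤B →
  upper k p pp p↑ B , lower k p pp (StrictlyIncreasing⇒Distinct p↑) B 1≤B ,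
  λ F⊂[1,B] → ≤-trans
    (*-monoʳ (0≤2^k*B k B) (weightedSum≥∏ B p pp (StrictlyIncreasing⇒Distinct p↑) (proj₂ ∘ F⊂[1,B])))
    (N≥weightedSum B p pp (StrictlyIncreasing⇒Distinct p↑))
  where
  -- The factor left by `pairSum-weights` when started at m = 0.
  C : ℚ
  C = fromℕ 2 ^ 16
  0<C : 0ℚ < C
  0<C = toWitness {a? = 0ℚ ℚ.<? C} _
  0≤C : 0ℚ ≤ C
  0≤C = <⇒≤ 0<C
  1≤C : 1ℚ ≤ C
  1≤C = ≤ᵇ⇒≤ _
  0≤1 : 0ℚ ≤ 1ℚ
  0≤1 = ≤ᵇ⇒≤ _
  0≤2^ : ∀ k → 0ℚ ≤ fromℕ 2 ^ k
  0≤2^ k = 0≤^ {fromℕ 2} k (≤ᵇ⇒≤ _)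
  0≤2^k*B : ∀ k B → 0ℚ ≤ fromℕ 2 ^ k * fromℕ B
  0≤2^k*B k B = 0≤* (0≤2^ k) (0≤fromℕ B)
  lower : ∀ k (p : Vector ℕ k) → AllPrime p → Distinct p → ∀ B → 1 ℕ.≤ B →
    fromℕ 2 ^ k * fromℕ B + fromℕ 2 ^ k * fromℕ B * ∑ (filter (1<n≤b? B) (F p)) (λ n → ½ ^ ω n * recip n)
    ≤ fromℕ (N B (F p))
  lower k p pp p! B 1≤B = begin
    t + t * s                     ≡⟨ solve 2 (λ t s → t :+ t :* s := t :* (con 1ℚ :+ s)) refl t s ⟩
    t * (1ℚ + s)                  ≤⟨ *-monoʳ (0≤2^k*B k B) (properDivisorSum≤ B p pp p! 1≤B) ⟩
    t * weightedSum B p           ≤⟨ N≥weightedSum B p pp p! ⟩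
    fromℕ (N B (F p))             ∎
    where
    open ≤-Reasoning
    open +-*-Solver
    t = fromℕ 2 ^ k * fromℕ B
    s = ∑ (filter (1<n≤b? B) (F p)) (λ n → ½ ^ ω n * recip n)
  upper : ∀ k (p : Vector ℕ k) → AllPrime p → StrictlyIncreasing p → ∀ B →
    fromℕ (N B (F p))
    ≤ C * fromℕ B * fromℕ 2 ^ k * ∏ (λ i → 1ℚ + recip (4 ℕ.* p i)) * (fromℕ B ⊓ (+ 5 / 4) ^ k)
    + C * fromℕ 2 ^ k * ∏ (λ i → 1ℚ + recip (3 ℕ.* p i)) * ((fromℕ B * (+ 3 / 2) ^ k) ⊓ fromℕ 2 ^ k)
  upper k p pp p↑ B = begin
    n                                           ≤⟨ ≤*⊓ {n} {C * b * t * P} {b} {(+ 5 / 4) ^ k} n≤B n≤5/4 ⟩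
    C * b * t * P * (b ⊓ (+ 5 / 4) ^ k)         ≡⟨ +-identityʳ _ ⟨
    C * b * t * P * (b ⊓ (+ 5 / 4) ^ k) + 0ℚ    ≤⟨ +-monoʳ-≤ (C * b * t * P * (b ⊓ (+ 5 / 4) ^ k)) 0≤rest ⟩
    C * b * t * P * (b ⊓ (+ 5 / 4) ^ k) + C * t * Q * ((b * (+ 3 / 2) ^ k) ⊓ t) ∎
    where
    open ≤-Reasoning
    open +-*-Solver
    n = fromℕ (N B (F p))
    b = fromℕ B
    t = fromℕ 2 ^ k
    P = ∏ (λ i → 1ℚ + recip (4 ℕ.* p i))
    Q = ∏ (λ i → 1ℚ + recip (3 ℕ.* p i))
    1≤P : 1ℚ ≤ P
    1≤P = 1≤∏ (λ i → recip (4 ℕ.* p i)) (λ i → 0≤recip (4 ℕ.* p i))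
    0≤bt : 0ℚ ≤ b * t
    0≤bt = 0≤* (0≤fromℕ B) (0≤2^ k)
    scale : ∀ {x y c} → 0ℚ ≤ y → 1ℚ ≤ c → 0ℚ ≤ c → x ≤ c * (b * t * y) → x ≤ c * b * t * P * y
    scale {x} {y} {c} 0≤y 1≤c 0≤c x≤ = begin
      x                         ≤⟨ x≤ ⟩
      c * (b * t * y)           ≡⟨ *-identityʳ _ ⟨
      c * (b * t * y) * 1ℚ      ≤⟨ *-monoʳ (0≤* 0≤c (0≤* 0≤bt 0≤y)) 1≤P ⟩
      c * (b * t * y) * P       ≡⟨ solve 5 (λ c b t y P → c :* (b :* t :* y) :* P := c :* b :* t :* P :* y) refl c b t y P ⟩
      c * b * t * P * y         ∎
    n≤B : n ≤ C * b * t * P * b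
    n≤B = scale (0≤fromℕ B) 1≤C 0≤C (begin
      n                   ≤⟨ N≤b²2^k B p pp (StrictlyIncreasing⇒Distinct p↑) ⟩
      b * (t * b)         ≡⟨ solve 2 (λ b t → b :* (t :* b) := con 1ℚ :* (b :* t :* b)) refl b t ⟩
      1ℚ * (b * t * b)    ≤⟨ *-monoˡ (0≤* 0≤bt (0≤fromℕ B)) 1≤C ⟩
      C * (b * t * b)     ∎)
    n≤5/4 : n ≤ C * b * t * P * (+ 5 / 4) ^ k
    n≤5/4 = scale (0≤^ {+ 5 / 4} k (≤ᵇ⇒≤ _)) 1≤C 0≤C (begin
      n                               ≤⟨ N≤[5/2]^k B p pp p↑ ⟩
      b * (C * (+ 5 / 2) ^ k)         ≡⟨ cong (λ x → b * (C * x)) (^-distribʳ-* (fromℕ 2) (+ 5 / 4) k) ⟩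
      b * (C * (t * (+ 5 / 4) ^ k))   ≡⟨ solve 4 (λ c b t y → b :* (c :* (t :* y)) := c :* (b :* t :* y)) refl C b t ((+ 5 / 4) ^ k) ⟩
      C * (b * t * (+ 5 / 4) ^ k)     ∎)
    0≤rest : 0ℚ ≤ C * t * Q * ((b * (+ 3 / 2) ^ k) ⊓ t)
    0≤rest = 0≤* (0≤* (0≤* 0≤C (0≤2^ k))
        (≤-trans 0≤1 (1≤∏ (λ i → recip (3 ℕ.* p i)) (λ i → 0≤recip (3 ℕ.* p i)))))
      (⊓-glb (0≤* (0≤fromℕ B) (0≤^ {+ 3 / 2} k (≤ᵇ⇒≤ _))) (0≤2^ k))
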